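{- Let $f(x)=\dfrac{1+x}{\cos(x)^{s+1}}$, regarded as a formal power series in $x$ whose coefficients are polynomials in the parameter $s$. Then for all $n\ge1$ and all $s$, $$\ddot H_n(f)=c_n\prod_{i=1}^{n-1}(s+1)_i=c_n\prod_{j=1}^{n-1}(s+j)^{\,n-j}, \qquad c_n=\frac{2^{\binom n2}\,\bigl((n-1)!!\bigr)^2\prod_{k=1}^{n-2}(k!!)^6}{\prod_{i=1}^{n-1}i!}.$$ The constant $c_n$ is exactly the value $\ddot H_n(f)\big|_{s=0}$ divided by $\prod_{i=1}^{n-1}i!$.
   Context: For a power series $f(x)=\sum_{k\ge0}a_kx^k/k!$, the dilated Hankel determinant is $\ddot H_n(f)=\det(a_{2i+j})_{0\le i,j\le n-1}$. $(s+1)_i=(s+1)(s+2)\cdots(s+i)$. Conventions: $m!!=m(m-2)(m-4)\cdots$ down to $1$ or $2$, with $0!!=(-1)!!=1$; empty products equal $1$. -}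

module Defs where

open import Level using (Level; _⊔_) renaming (suc to lsuc)
open import Algebra.Bundles using (CommutativeRing)
open import Algebra.Morphism.Structures using (IsRingHomomorphism)
open import Data.Fin.Base using (Fin; zero; suc; toℕ; punchIn)
open import Data.Integer.Base using (+_)
open import Data.Nat.Base as ℕ using (ℕ; zero; suc; NonZero; _∸_; _!)
open import Data.Nat.Combinatorics using (_C_)
open import Data.Nat.Properties as ℕₚ using (_!≢0; m*n≢0)
open import Data.Rational.Base as ℚ using (ℚ)
import Algebra.Properties.CommutativeMonoid.Sum as MonoidSum
import Algebra.Properties.Monoid.Mult as MonoidMult
import Algebra.Properties.Semiring.Exp as Exp
import Algebra.Properties.Semiring.Sum as SemiringSum

private
  module Πℕ = MonoidSum ℕₚ.*-1-commutativeMonoid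

-- ∏ℕ m g = g 1 · g 2 ⋯ g m
∏ℕ : ℕ → (ℕ → ℕ) → ℕ
∏ℕ m g = Πℕ.sum {m} (λ k → g (suc (toℕ k)))

infix 9 _!!

_!! : ℕ → ℕ
zero !!          = 1
suc zero !!      = 1
suc (suc m) !!   = suc (suc m) ℕ.* m !!

∏ℕ-nonZero : ∀ m (g : ℕ → ℕ) → (∀ k → NonZero (g k)) → NonZero (∏ℕ m g)
∏ℕ-nonZero zero    g nz = _
∏ℕ-nonZero (suc m) g nz =
  m*n≢0 (g 1) (∏ℕ m (λ k → g (suc k)))
    {{nz 1}} {{∏ℕ-nonZero m (λ k → g (suc k)) (λ k → nz (suc k))}}

superfactorial : ℕ → ℕ
superfactorial m = ∏ℕ m _!

superfactorial≢0 : ∀ m → NonZero (superfactorial m)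
superfactorial≢0 m = ∏ℕ-nonZero m _! _!≢0

-- Intended for n ≥ 1.  At n = 1 the truncated n ∸ 2 = 0 gives the empty
-- product, as does the upper limit n − 2 = −1.
constant : ℕ → ℚ
constant n =
  ((+ (2 ℕ.^ (n C 2) ℕ.* ((n ∸ 1) !!) ℕ.^ 2 ℕ.* ∏ℕ (n ∸ 2) (λ k → (k !!) ℕ.^ 6)))
    ℚ./ superfactorial (n ∸ 1)) {{superfactorial≢0 (n ∸ 1)}}

-- Commutative ℚ-algebras.  An identity between polynomials in s holds in ℚ[s]
-- iff it holds for every element s of every commutative ℚ-algebra: ℚ[s] with
-- its indeterminate is the universal instance, numerical values are others.
record CommutativeℚAlgebra (c ℓ : Level) : Set (lsuc (c ⊔ ℓ)) where
  field
    commutativeRing : CommutativeRing c ℓ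

  open CommutativeRing commutativeRing public

  field
    ι                    : ℚ → Carrier
    ι-isRingHomomorphism : IsRingHomomorphism ℚ.+-*-rawRing rawRing ι

module Series {c ℓ : Level} (A : CommutativeℚAlgebra c ℓ) where

  open CommutativeℚAlgebra A hiding (zero)
  open SemiringSum semiring using (sum)
  open MonoidSum *-commutativeMonoid using () renaming (sum to product)
  open MonoidMult +-monoid using () renaming (_×_ to _·_)
  open Exp semiring public using (_^_)

  ⟦_⟧ : ℕ → Carrier
  ⟦ m ⟧ = m · 1#

  1/_! : ℕ → Carrier
  1/ k ! = ι (((+ 1) ℚ./ (k !)) {{k !≢0}})

  -- ∏₁ m g = g 1 * g 2 * ⋯ * g m
  ∏₁ : ℕ → (ℕ → Carrier) → Carrier
  ∏₁ m g = product {m} (λ k → g (suc (toℕ k)))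

  pochhammer : Carrier → ℕ → Carrier
  pochhammer a m = product {m} (λ i → a + ⟦ toℕ i ⟧)

  binomial : Carrier → ℕ → Carrier
  binomial a m = product {m} (λ i → a - ⟦ toℕ i ⟧) * 1/ m !

  -- u k is the ordinary coefficient of xᵏ (not divided by 1/k!).
  PowerSeries : Set c
  PowerSeries = ℕ → Carrier

  1ₛ : PowerSeries
  1ₛ zero    = 1#
  1ₛ (suc _) = 0#

  X : PowerSeries
  X zero          = 0#
  X (suc zero)    = 1#
  X (suc (suc _)) = 0#

  infixl 6 _+ₛ_ _-ₛ_
  infixl 7 _*ₛ_
  infixr 8 _^ₛ_ _^^_

  _+ₛ_ _-ₛ_ _*ₛ_ : PowerSeries → PowerSeries → PowerSeries
  (u +ₛ v) k = u k + v k
  (u -ₛ v) k = u k - v k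
  (u *ₛ v) k = sum {suc k} (λ i → u (toℕ i) * v (k ∸ toℕ i))

  _^ₛ_ : PowerSeries → ℕ → PowerSeries
  u ^ₛ zero  = 1ₛ
  u ^ₛ suc m = u *ₛ (u ^ₛ m)

  -- uᵃ = Σₘ binomial(a,m) (u − 1)ᵐ for a series u with constant term 1.  Then
  -- (u − 1)ᵐ has no terms of degree below m, so only m ≤ k contribute to xᵏ.
  _^^_ : PowerSeries → Carrier → PowerSeries
  (u ^^ a) k = sum {suc k} (λ m → binomial a (toℕ m) * ((u -ₛ 1ₛ) ^ₛ toℕ m) k)

  -- The k-th derivative of cos at 0.
  cosDerivative : ℕ → Carrier
  cosDerivative zero          = 1#
  cosDerivative (suc zero)    = 0#
  cosDerivative (suc (suc k)) = - cosDerivative k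

  cos : PowerSeries
  cos k = cosDerivative k * 1/ k !

  f : Carrier → PowerSeries
  f s = (1ₛ +ₛ X) *ₛ cos ^^ (- (s + 1#))

  Matrix : ℕ → Set c
  Matrix n = Fin n → Fin n → Carrier

  -- Laplace expansion along the first row.
  det : ∀ n → Matrix n → Carrier
  det zero    M = 1#
  det (suc n) M =
    sum (λ j → (- 1#) ^ toℕ j * M zero j * det n (λ i k → M (suc i) (punchIn j k)))

  egfCoeff : PowerSeries → ℕ → Carrier
  egfCoeff u k = ⟦ k ! ⟧ * u k

  dilatedHankel : ℕ → PowerSeries → Carrier
  dilatedHankel n u = det n (λ i j → egfCoeff u (2 ℕ.* toℕ i ℕ.+ toℕ j))

{-# OPTIONS --safe #-}

-- Put t = s + 1 and F = secᵗ.  The (i, j) entry is the derivative of order 2i at 0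
-- of the j-th derivative of (1 + x) F, so only the even part of the latter
-- matters.  Differentiating products F tanˡ twice shows that this even part is
-- (t)ⱼ Bⱼ plus a combination of B₀, …, Bⱼ₋₁, where Bₗ is the even part of
-- (1 + x) F tanˡ, i.e. F tanˡ for even l and x F tanˡ for odd l.  Hence column
-- operations split off ∏ (t)ⱼ.  Writing x = arctan (tan x), the Bₗ are F times
-- power series in tan², and B₀ and B₁ are the cases n = 0, 1 of
--   Kₙ = F tan²ⁿ ₂F₁(n/2, (n+1)/2; n+1/2; -tan²),
-- the remainders in the continued fraction of arctan.  The contiguity relation
-- tan² Kₙ = Kₙ₊₁ + (n+1)² / ((2n+1)(2n+3)) Kₙ₊₂ makes Bₗ a multiple of Kₗ plus a
-- combination of K₀, …, Kₗ₋₁, and Kₙ vanishes to order 2n at 0, so the determinant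
-- is the product of the diagonal of a triangular matrix.
module Submission where

open import Defs
open import Level using (Level; _⊔_)
open import Algebra.Bundles using (Monoid)
open import Algebra.Morphism.Structures using (IsRingHomomorphism)
import Algebra.Properties.CommutativeMonoid.Sum as MonoidSum
import Algebra.Properties.Monoid.Sum as Fold
import Algebra.Properties.Semiring.Mult as Mult
import Algebra.Properties.Semiring.Sum as SemiringSum
import Algebra.Solver.Ring as RingSolver
open import Algebra.Solver.Ring.AlmostCommutativeRing
  using (fromCommutativeRing; _-Raw-AlmostCommutative⟶_)
open import Data.Fin.Base using (Fin; zero; suc; toℕ; punchIn; punchOut)
import Data.Fin.Properties as Fin
open import Data.Integer.Base as ℤ using (+_; -[1+_])
import Data.Integer.Properties as ℤ
open import Data.Maybe.Base using (Maybe; map)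
open import Data.Nat.Base as ℕ using (ℕ; zero; suc; pred; z≤n; s≤s; _!; _≤_; _<_; _∸_)
open import Data.Nat.Combinatorics using (_C_; nC1≡n; nCk+nC[k+1]≡[n+1]C[k+1])
import Data.Nat.Properties as ℕ
open import Data.Nat.Solver using (module +-*-Solver)
open import Data.Product.Base using (_×_; _,_; ∃-syntax)
open import Data.Rational.Base as ℚ using (ℚ; mkℚ; 0ℚ; 1ℚ; ½; fromℚᵘ; _/_)
import Data.Rational.Properties as ℚ
open import Data.Rational.Unnormalised.Base as ℚᵘ using (mkℚᵘ; *≡*)
import Data.Rational.Unnormalised.Properties as ℚᵘ
open import Data.Sum.Base using (_⊎_; inj₁; inj₂)
open import Data.Vec.Functional using (Vector)
open import Function.Base using (_∘_)
open import Relation.Binary.PropositionalEquality as ≡ using (_≡_; _≢_; _≗_)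
import Relation.Binary.Reasoning.Setoid as SetoidReasoning
open import Relation.Nullary.Decidable using (yes; no; dec⇒maybe)
open import Relation.Nullary.Negation using (contradiction)

-- `A` may have zero divisors, so (t)ⱼ cannot be divided out and only positive integers are
-- inverted. The functions sec, tan and arctan are never constructed: they enter through the array
-- `e k m`, fixed by its values at k = 0 and by (F tanᵐ)' = (t+m) F tanᵐ⁺¹ + m F tanᵐ⁻¹. As F tanᵐ
-- has order m at 0, a series in tan is a finite sum at each derivative order. The series
-- `cos ^^ (- t)` of the statement is linked to the array by showing that its binomial expansion
-- obeys the same recurrence.
--
-- Two triangular changes of columns are composed: from the derivatives to the Bⱼ, with leading
-- coefficients (t)ⱼ, and from the Bⱼ to the Kⱼ, with leading coefficients `η j` that do not involve
-- t. The diagonal is then (2j)! η j (t)ⱼ, where (2j)! is the derivative of order 2j of F tan²ʲ at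
-- 0. Since `η` multiplies the contiguity constants of every other index, double factorials appear:
-- η j = ((j-1)!!)² / (2j-1)!!, and hence (2j)! η j = 2ʲ j! ((j-1)!!)².

private
  module Πℕ = MonoidSum ℕ.*-1-commutativeMonoid

-- Folds over ranges, doubling, parity and fractions.

module RangeFold {a ℓ} (M : Monoid a ℓ) where
  open Monoid M
  open Fold M using (sum)

  sum-last : ∀ n (g : ℕ → Carrier) →
    sum {suc n} (λ i → g (toℕ i)) ≈ sum {n} (λ i → g (toℕ i)) ∙ g n
  sum-last zero    g = trans (identityʳ _) (sym (identityˡ _))
  sum-last (suc n) g = trans (∙-congˡ (sum-last n (g ∘ suc))) (sym (assoc _ _ _))

+-suc-suc : ∀ m n → m ℕ.+ suc (suc n) ≡ suc (suc (m ℕ.+ n))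
+-suc-suc m n = ≡.trans (ℕ.+-suc m (suc n)) (≡.cong suc (ℕ.+-suc m n))

-- In contrast to 2 * suc n, the double of suc n unfolds to two successors.
dbl : ℕ → ℕ
dbl zero    = zero
dbl (suc n) = suc (suc (dbl n))

dbl≡2* : ∀ n → dbl n ≡ 2 ℕ.* n
dbl≡2* zero    = ≡.refl
dbl≡2* (suc n) = ≡.cong suc (≡.trans (≡.cong suc (dbl≡2* n)) (≡.sym (ℕ.+-suc n (n ℕ.+ 0))))

n≤dbl[n] : ∀ n → n ≤ dbl n
n≤dbl[n] zero    = z≤n
n≤dbl[n] (suc n) = s≤s (ℕ.m≤n⇒m≤1+n (n≤dbl[n] n))

dbl-mono-≤ : ∀ {m n} → m ≤ n → dbl m ≤ dbl n
dbl-mono-≤ z≤n       = z≤n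
dbl-mono-≤ (s≤s m≤n) = s≤s (s≤s (dbl-mono-≤ m≤n))

dbl-+ : ∀ m n → dbl (m ℕ.+ n) ≡ dbl m ℕ.+ dbl n
dbl-+ zero    n = ≡.refl
dbl-+ (suc m) n = ≡.cong (λ k → suc (suc k)) (dbl-+ m n)

parity : ∀ n → (∃[ q ] n ≡ dbl q) ⊎ (∃[ q ] n ≡ suc (dbl q))
parity zero    = inj₁ (0 , ≡.refl)
parity (suc n) with parity n
... | inj₁ (q , ≡.refl) = inj₂ (q , ≡.refl)
... | inj₂ (q , ≡.refl) = inj₁ (suc q , ≡.refl)

fromℚᵘ-homo-+ : ∀ p q → fromℚᵘ p ℚ.+ fromℚᵘ q ≡ fromℚᵘ (p ℚᵘ.+ q)
fromℚᵘ-homo-+ p q = ℚ.toℚᵘ-injective (ℚᵘ.≃-trans (ℚ.toℚᵘ-homo-+ (fromℚᵘ p) (fromℚᵘ q))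
  (ℚᵘ.≃-trans (ℚᵘ.+-cong (ℚ.toℚᵘ-fromℚᵘ p) (ℚ.toℚᵘ-fromℚᵘ q))
    (ℚᵘ.≃-sym (ℚ.toℚᵘ-fromℚᵘ (p ℚᵘ.+ q)))))

fromℚᵘ-homo-* : ∀ p q → fromℚᵘ p ℚ.* fromℚᵘ q ≡ fromℚᵘ (p ℚᵘ.* q)
fromℚᵘ-homo-* p q = ℚ.toℚᵘ-injective (ℚᵘ.≃-trans (ℚ.toℚᵘ-homo-* (fromℚᵘ p) (fromℚᵘ q))
  (ℚᵘ.≃-trans (ℚᵘ.*-cong (ℚ.toℚᵘ-fromℚᵘ p) (ℚ.toℚᵘ-fromℚᵘ q))
    (ℚᵘ.≃-sym (ℚ.toℚᵘ-fromℚᵘ (p ℚᵘ.* q)))))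

suc/1 : ∀ n → (+ suc n) ℚ./ 1 ≡ 1ℚ ℚ.+ ((+ n) ℚ./ 1)
suc/1 n = ≡.sym (≡.trans (fromℚᵘ-homo-+ (mkℚᵘ (+ 1) 0) (mkℚᵘ (+ n) 0))
  (ℚ.fromℚᵘ-cong {mkℚᵘ (+ 1) 0 ℚᵘ.+ mkℚᵘ (+ n) 0} {mkℚᵘ (+ suc n) 0}
    (*≡* (≡.cong (λ m → (+ 1 ℤ.+ m) ℤ.* + 1) (ℤ.*-identityʳ (+ n))))))

/-*-/1 : ∀ m d .{{_ : ℕ.NonZero d}} → ((+ m) ℚ./ d) ℚ.* ((+ d) ℚ./ 1) ≡ (+ m) ℚ./ 1
/-*-/1 m (suc d) = ≡.trans (fromℚᵘ-homo-* (mkℚᵘ (+ m) d) (mkℚᵘ (+ suc d) 0))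
  (ℚ.fromℚᵘ-cong {mkℚᵘ (+ m) d ℚᵘ.* mkℚᵘ (+ suc d) 0} {mkℚᵘ (+ m) 0}
    (*≡* (ℤ.*-assoc (+ m) (+ suc d) (+ 1))))

-- Ring solving over ℚ, and positive integers as units.

module Solver {c ℓ : Level} (A : CommutativeℚAlgebra c ℓ) where
  open CommutativeℚAlgebra A hiding (zero)
  open IsRingHomomorphism ι-isRingHomomorphism

  -- Unlike ι, this sends 0 and 1 to 0# and 1# definitionally, as the solver needs to
  -- recognise these constants in goals.
  ι′ : ℚ → Carrier
  ι′ (mkℚ (+ 0) 0 _) = 0#
  ι′ (mkℚ (+ 1) 0 _) = 1#
  ι′ q               = ι q

  ι′≈ι : ∀ q → ι′ q ≈ ι q
  ι′≈ι (mkℚ (+ 0) 0 _)             = sym 0#-homo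
  ι′≈ι (mkℚ (+ 1) 0 _)             = sym 1#-homo
  ι′≈ι (mkℚ (+ 0) (suc _) _)       = refl
  ι′≈ι (mkℚ (+ 1) (suc _) _)       = refl
  ι′≈ι (mkℚ (+ suc (suc _)) _ _)   = refl
  ι′≈ι (mkℚ -[1+ _ ] _ _) = refl

  private
    morphism : ℚ.+-*-rawRing -Raw-AlmostCommutative⟶ fromCommutativeRing commutativeRing
    morphism = record
      { ⟦_⟧    = ι′
      ; +-homo = λ p q → trans (ι′≈ι _) (trans (+-homo p q) (sym (+-cong (ι′≈ι p) (ι′≈ι q))))
      ; *-homo = λ p q → trans (ι′≈ι _) (trans (*-homo p q) (sym (*-cong (ι′≈ι p) (ι′≈ι q))))
      ; -‿homo = λ p → trans (ι′≈ι _) (trans (-‿homo p) (sym (-‿cong (ι′≈ι p))))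
      ; 0-homo = refl
      ; 1-homo = refl
      }

    weaklyDecidable : ∀ p q → Maybe (ι′ p ≈ ι′ q)
    weaklyDecidable p q = map (λ p≡q → reflexive (≡.cong ι′ p≡q)) (dec⇒maybe (p ℚ.≟ q))

  open RingSolver ℚ.+-*-rawRing (fromCommutativeRing commutativeRing) morphism weaklyDecidable public
    using (Polynomial; con; solve; _:=_; _:+_; _:*_; _:-_; :-_)

  :0 :1 : ∀ {n} → Polynomial n
  :0 = con 0ℚ
  :1 = con 1ℚ

  infix 10 :⟦_⟧
  -- Unfolds in step with `⟦_⟧`, so that a numeral in a goal and its solver term agree by
  -- computation.
  :⟦_⟧ : ∀ {n} → ℕ → Polynomial n
  :⟦ zero ⟧  = :0
  :⟦ suc k ⟧ = :1 :+ :⟦ k ⟧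

module Scalars {c ℓ : Level} (A : CommutativeℚAlgebra c ℓ) where
  open CommutativeℚAlgebra A hiding (zero)
  open Series A
  open Solver A
  open IsRingHomomorphism ι-isRingHomomorphism
  open Mult semiring using (×-homo-+; ×1-homo-*)
  open SetoidReasoning setoid

  ⟦⟧-+ : ∀ m n → ⟦ m ℕ.+ n ⟧ ≈ ⟦ m ⟧ + ⟦ n ⟧
  ⟦⟧-+ = ×-homo-+ 1#

  ⟦⟧-* : ∀ m n → ⟦ m ℕ.* n ⟧ ≈ ⟦ m ⟧ * ⟦ n ⟧
  ⟦⟧-* = ×1-homo-*

  ⟦⟧-dbl : ∀ n → ⟦ dbl n ⟧ ≈ ⟦ n ⟧ + ⟦ n ⟧
  ⟦⟧-dbl zero    = sym (+-identityˡ _)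
  ⟦⟧-dbl (suc n) = trans (+-congˡ (+-congˡ (⟦⟧-dbl n)))
    (solve 1 (λ x → :1 :+ (:1 :+ (x :+ x)) := :1 :+ x :+ (:1 :+ x)) refl ⟦ n ⟧)

  ι-/1 : ∀ n → ι ((+ n) ℚ./ 1) ≈ ⟦ n ⟧
  ι-/1 zero    = 0#-homo
  ι-/1 (suc n) = begin
    ι ((+ suc n) ℚ./ 1)                  ≡⟨ ≡.cong ι (suc/1 n) ⟩
    ι (1ℚ ℚ.+ ((+ n) ℚ./ 1))               ≈⟨ +-homo 1ℚ ((+ n) ℚ./ 1) ⟩
    ι 1ℚ + ι ((+ n) ℚ./ 1)               ≈⟨ +-cong 1#-homo (ι-/1 n) ⟩
    1# + ⟦ n ⟧                           ∎

  ι-/-* : ∀ m d .{{_ : ℕ.NonZero d}} → ι ((+ m) ℚ./ d) * ⟦ d ⟧ ≈ ⟦ m ⟧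
  ι-/-* m d = begin
    ι ((+ m) ℚ./ d) * ⟦ d ⟧              ≈⟨ *-congˡ (ι-/1 d) ⟨
    ι ((+ m) ℚ./ d) * ι ((+ d) ℚ./ 1)    ≈⟨ *-homo ((+ m) ℚ./ d) ((+ d) ℚ./ 1) ⟨
    ι (((+ m) ℚ./ d) ℚ.* ((+ d) ℚ./ 1))      ≡⟨ ≡.cong ι (/-*-/1 m d) ⟩
    ι ((+ m) ℚ./ 1)                      ≈⟨ ι-/1 m ⟩
    ⟦ m ⟧                                ∎

  inv : ℕ → Carrier
  inv n = ι ((+ 1) ℚ./ suc n)

  inv-inverse : ∀ n → ⟦ suc n ⟧ * inv n ≈ 1#
  inv-inverse n = trans (*-comm _ _) (trans (ι-/-* 1 (suc n)) (+-identityʳ 1#))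

  1/!-inverse : ∀ n → ⟦ n ! ⟧ * 1/ n ! ≈ 1#
  1/!-inverse n = trans (*-comm _ _) (trans (ι-/-* 1 (n !) {{n ℕ.!≢0}}) (+-identityʳ 1#))

  -- A positive integer is a unit in every ℚ-algebra, so it cancels even in the presence of zero
  -- divisors.
  cancel-⟦⟧ : ∀ d .{{_ : ℕ.NonZero d}} {x y} → ⟦ d ⟧ * x ≈ ⟦ d ⟧ * y → x ≈ y
  cancel-⟦⟧ (suc d) {x} {y} eq = begin
    x                        ≈⟨ insert x ⟩
    inv d * (⟦ suc d ⟧ * x)  ≈⟨ *-congˡ eq ⟩
    inv d * (⟦ suc d ⟧ * y)  ≈⟨ insert y ⟨
    y                        ∎
    where
    insert : ∀ x → x ≈ inv d * (⟦ suc d ⟧ * x)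
    insert x = begin
      x                        ≈⟨ *-identityˡ x ⟨
      1# * x                   ≈⟨ *-congʳ (inv-inverse d) ⟨
      ⟦ suc d ⟧ * inv d * x    ≈⟨ solve 3 (λ d i x → d :* i :* x := i :* (d :* x)) refl _ _ _ ⟩
      inv d * (⟦ suc d ⟧ * x)  ∎

-- The numerical part of the diagonal and its product.

pivot : ℕ → ℕ
pivot n = 2 ℕ.^ n ℕ.* n ! ℕ.* (n ∸ 1) !! ℕ.^ 2

-- With `pivot n` standing for (2n)! η n, the factor is (2n+1)(2n+2)(2n+3)(2n+4) κ n = 4 (n+1)³
-- (n+2). The case n = 0 relies on 0 ∸ 1 = 0 and 0!! = 1.
pivot-step : ∀ n → pivot (suc (suc n)) ≡ 4 ℕ.* (suc n ℕ.* suc n ℕ.* (suc n ℕ.* suc (suc n))) ℕ.* pivot n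
pivot-step zero    = ≡.refl
pivot-step (suc n) = solve 4 (λ n p f d →
    let n′ = con 1 :+ n in
    con 2 :* (con 2 :* p) :* ((con 2 :+ n′) :* ((con 1 :+ n′) :* f))
      :* (((con 1 :+ n′) :* d) :* (((con 1 :+ n′) :* d) :* con 1))
    := con 4 :* ((con 1 :+ n′) :* (con 1 :+ n′) :* ((con 1 :+ n′) :* (con 2 :+ n′)))
      :* (p :* f :* (d :* (d :* con 1))))
  ≡.refl n (2 ℕ.^ suc n) (suc n !) (n !!)
  where open +-*-Solver

!-split : ∀ n → suc n ! ≡ suc n !! ℕ.* n !!
!-split zero    = ≡.refl
!-split (suc n) = ≡.trans (≡.cong (suc (suc n) ℕ.*_) (≡.trans (!-split n) (ℕ.*-comm (suc n !!) (n !!))))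
  (≡.sym (ℕ.*-assoc (suc (suc n)) (n !!) (suc n !!)))

∏pivot : ℕ → ℕ
∏pivot m = Πℕ.sum {suc m} (λ i → pivot (toℕ i))

numerator : ℕ → ℕ
numerator m = 2 ℕ.^ (suc m C 2) ℕ.* m !! ℕ.^ 2 ℕ.* ∏ℕ (m ∸ 1) (λ k → k !! ℕ.^ 6)

C2-step : ∀ n → suc n C 2 ≡ n ℕ.+ n C 2
C2-step n = ≡.trans (≡.sym (nCk+nC[k+1]≡[n+1]C[k+1] n 1)) (≡.cong (ℕ._+ n C 2) (nC1≡n n))

-- Passing from m to m+1 multiplies the left side by 2ᵐ⁺¹ ((m+1)!)² (m!!)². Splitting (m+1)! =
-- (m+1)!! m!! yields (m!!)⁴, and with the square (m!!)² already present in the previous numerator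
-- this makes the sixth power.
∏pivot*superfactorial : ∀ m → ∏pivot m ℕ.* superfactorial m ≡ numerator m
∏pivot*superfactorial zero          = ≡.refl
∏pivot*superfactorial (suc zero)    = ≡.refl
∏pivot*superfactorial (suc n@(suc m)) = begin
  ∏pivot (suc n) ℕ.* superfactorial (suc n)
    ≡⟨ ≡.cong₂ ℕ._*_ (sum-last (suc n) pivot) (sum-last n (_! ∘ suc)) ⟩
  (∏pivot n ℕ.* (2 ℕ.^ suc n ℕ.* suc n ! ℕ.* n !! ℕ.^ 2)) ℕ.* (superfactorial n ℕ.* suc n !)
    ≡⟨ solve 5 (λ p t f d s → (p :* (t :* f :* (d :^ 2))) :* (s :* f) := p :* s :* (t :* f :* f :* (d :^ 2))) ≡.refl
         (∏pivot n) (2 ℕ.^ suc n) (suc n !) (n !!) (superfactorial n) ⟩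
  ∏pivot n ℕ.* superfactorial n ℕ.* (2 ℕ.^ suc n ℕ.* suc n ! ℕ.* suc n ! ℕ.* n !! ℕ.^ 2)
    ≡⟨ ≡.cong₂ (λ x f → x ℕ.* (2 ℕ.^ suc n ℕ.* f ℕ.* f ℕ.* n !! ℕ.^ 2)) (∏pivot*superfactorial n) (!-split n) ⟩
  2 ℕ.^ (suc n C 2) ℕ.* n !! ℕ.^ 2 ℕ.* P ℕ.* (2 ℕ.^ suc n ℕ.* (suc n !! ℕ.* n !!) ℕ.* (suc n !! ℕ.* n !!) ℕ.* n !! ℕ.^ 2)
    ≡⟨ solve 5 (λ b d p t e → b :* (d :^ 2) :* p :* (t :* (e :* d) :* (e :* d) :* (d :^ 2)) := t :* b :* (e :^ 2) :* (p :* (d :^ 6))) ≡.refl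
         (2 ℕ.^ (suc n C 2)) (n !!) P (2 ℕ.^ suc n) (suc n !!) ⟩
  2 ℕ.^ suc n ℕ.* 2 ℕ.^ (suc n C 2) ℕ.* suc n !! ℕ.^ 2 ℕ.* (P ℕ.* n !! ℕ.^ 6)
    ≡⟨ ≡.cong₂ (λ x y → x ℕ.* suc n !! ℕ.^ 2 ℕ.* y)
         (≡.trans (≡.sym (ℕ.^-distribˡ-+-* 2 (suc n) (suc n C 2))) (≡.cong (2 ℕ.^_) (≡.sym (C2-step (suc n)))))
         (≡.sym (sum-last m (λ k → suc k !! ℕ.^ 6))) ⟩
  numerator (suc n) ∎
  where
  open +-*-Solver
  open ≡.≡-Reasoning
  open RangeFold ℕ.*-1-monoid
  P = ∏ℕ m (λ k → k !! ℕ.^ 6)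

-- Laplace determinants: row operations and triangular factors.

punchIn-swap : ∀ {n} {j k : Fin (suc (suc n))} (j≢k : j ≢ k) (k≢j : k ≢ j) x →
               punchIn j (punchIn (punchOut j≢k) x) ≡ punchIn k (punchIn (punchOut k≢j) x)
punchIn-swap {_}     {zero}  {zero}  j≢k k≢j x       = contradiction ≡.refl j≢k
punchIn-swap {_}     {zero}  {suc k} j≢k k≢j x       = ≡.refl
punchIn-swap {_}     {suc j} {zero}  j≢k k≢j x       = ≡.refl
punchIn-swap {suc _} {suc j} {suc k} j≢k k≢j zero    = ≡.refl
punchIn-swap {suc _} {suc j} {suc k} j≢k k≢j (suc x) =
  ≡.cong suc (punchIn-swap (j≢k ∘ ≡.cong suc) (k≢j ∘ ≡.cong suc) x)

module Determinant {c ℓ : Level} (A : CommutativeℚAlgebra c ℓ) where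
  open CommutativeℚAlgebra A hiding (zero)
  open Series A
  open Solver A
  open SemiringSum semiring
  open MonoidSum *-commutativeMonoid using () renaming (sum to product)
  open SetoidReasoning setoid

  sum-zero : ∀ {n} {t : Vector Carrier n} → (∀ i → t i ≈ 0#) → sum t ≈ 0#
  sum-zero {n} t≈0 = trans (sum-cong-≋ t≈0) (sum-replicate-zero n)

  det-cong : ∀ n {M N : Matrix n} → (∀ i j → M i j ≈ N i j) → det n M ≈ det n N
  det-cong zero    M≈N = refl
  det-cong (suc n) M≈N = sum-cong-≋ λ j →
    *-cong (*-congˡ {x = (- 1#) ^ toℕ j} (M≈N zero j)) (det-cong n (λ i k → M≈N (suc i) (punchIn j k)))

  sign : ℕ → Carrier
  sign m = (- 1#) ^ m

  -- For j < k, removing column j first lowers the position of k by one, whereas removing k first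
  -- leaves j in place; the exponents differ by one.
  sign-swap : ∀ {n} {j k : Fin (suc n)} (j≢k : j ≢ k) (k≢j : k ≢ j) →
    sign (toℕ j) * sign (toℕ (punchOut j≢k)) ≈ - (sign (toℕ k) * sign (toℕ (punchOut k≢j)))
  sign-swap {_}     {zero}  {zero}  j≢k k≢j = contradiction ≡.refl j≢k
  sign-swap {suc _} {zero}  {suc k} j≢k k≢j =
    solve 1 (λ x → :1 :* x := :- ((:- :1 :* x) :* :1)) refl _
  sign-swap {suc _} {suc j} {zero}  j≢k k≢j =
    solve 1 (λ x → (:- :1 :* x) :* :1 := :- (:1 :* x)) refl _
  sign-swap {suc _} {suc j} {suc k} j≢k k≢j = begin
    (- 1# * x) * (- 1# * x′)   ≈⟨ signs x x′ ⟩
    x * x′                     ≈⟨ sign-swap (j≢k ∘ ≡.cong suc) (k≢j ∘ ≡.cong suc) ⟩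
    - (y * y′)                 ≈⟨ -‿cong (signs y y′) ⟨
    - ((- 1# * y) * (- 1# * y′)) ∎
    where
    x  = sign (toℕ j)
    y  = sign (toℕ k)
    x′ = sign (toℕ (punchOut (j≢k ∘ ≡.cong suc)))
    y′ = sign (toℕ (punchOut (k≢j ∘ ≡.cong suc)))
    signs : ∀ u v → (- 1# * u) * (- 1# * v) ≈ u * v
    signs = solve 2 (λ u v → (:- :1 :* u) :* (:- :1 :* v) := u :* v) refl

  expand : ∀ {n} → Vector Carrier (suc n) → (Fin n → Vector Carrier (suc n)) → Carrier
  expand {n} a r =
    sum (λ j → sign (toℕ j) * a j * det n (λ i k → r i (punchIn j k)))

  module _ {n : ℕ} (D : (Fin n → Fin (suc (suc n))) → Carrier)
           (D-cong : ∀ {σ τ} → σ ≗ τ → D σ ≈ D τ) where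

    -- A determinant expanded along its top two rows. Keeping the complementary minor abstract, as a
    -- function `D` of the remaining columns, separates antisymmetry in the two rows from everything
    -- below them.
    expand₂ : (a b : Vector Carrier (suc (suc n))) → Carrier
    expand₂ a b = sum λ j → sign (toℕ j) * a j *
      sum λ j′ → sign (toℕ j′) * b (punchIn j j′) * D (punchIn j ∘ punchIn j′)

    private
      term : (a b : Vector Carrier (suc (suc n))) → ∀ {j k} → j ≢ k → Carrier
      term a b {j} {k} j≢k = sign (toℕ j) * sign (toℕ (punchOut j≢k))
        * (a j * b k) * D (punchIn j ∘ punchIn (punchOut j≢k))

      -- Zeros on the diagonal complete the sum over pairs of distinct columns to a full square,
      -- where the order of summation can be interchanged.
      entry : (a b : Vector Carrier (suc (suc n))) → ∀ j k → Carrier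
      entry a b j k with j Fin.≟ k
      ... | yes _  = 0#
      ... | no j≢k = term a b j≢k

      entry-diagonal : ∀ a b j → entry a b j j ≈ 0#
      entry-diagonal a b j with j Fin.≟ j
      ... | yes _  = refl
      ... | no j≢j = contradiction ≡.refl j≢j

      entry-punchIn : ∀ a b j j′ → entry a b j (punchIn j j′) ≈
        sign (toℕ j) * a j * (sign (toℕ j′) * b (punchIn j j′) * D (punchIn j ∘ punchIn j′))
      entry-punchIn a b j j′ with j Fin.≟ punchIn j j′
      ... | yes j≡ = contradiction (≡.sym j≡) (Fin.punchInᵢ≢i j j′)
      ... | no j≢  = begin
        sign (toℕ j) * sign (toℕ (punchOut j≢)) * (a j * b (punchIn j j′)) * D (punchIn j ∘ punchIn (punchOut j≢))
          ≡⟨ ≡.cong (λ z → sign (toℕ j) * sign (toℕ z) * (a j * b (punchIn j j′)) * D (punchIn j ∘ punchIn z))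
               (≡.trans (Fin.punchOut-cong j ≡.refl) (Fin.punchOut-punchIn j)) ⟩
        sign (toℕ j) * sign (toℕ j′) * (a j * b (punchIn j j′)) * D (punchIn j ∘ punchIn j′)
          ≈⟨ solve 5 (λ s s′ x y d → s :* s′ :* (x :* y) :* d := s :* x :* (s′ :* y :* d)) refl _ _ _ _ _ ⟩
        sign (toℕ j) * a j * (sign (toℕ j′) * b (punchIn j j′) * D (punchIn j ∘ punchIn j′)) ∎

      entry-swap : ∀ a b j k → entry a b j k ≈ - entry b a k j
      entry-swap a b j k with j Fin.≟ k | k Fin.≟ j
      ... | yes _   | yes _   = solve 0 (:0 := :- :0) refl
      ... | yes j≡k | no k≢j  = contradiction (≡.sym j≡k) k≢j
      ... | no j≢k  | yes k≡j = contradiction (≡.sym k≡j) j≢k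
      ... | no j≢k  | no k≢j  = begin
        sign (toℕ j) * sign (toℕ (punchOut j≢k)) * (a j * b k) * D (punchIn j ∘ punchIn (punchOut j≢k))
          ≈⟨ *-cong (*-congʳ (sign-swap j≢k k≢j)) (D-cong (punchIn-swap j≢k k≢j)) ⟩
        - (sign (toℕ k) * sign (toℕ (punchOut k≢j))) * (a j * b k) * D (punchIn k ∘ punchIn (punchOut k≢j))
          ≈⟨ solve 4 (λ s x y d → :- s :* (x :* y) :* d := :- (s :* (y :* x) :* d)) refl _ _ _ _ ⟩
        - term b a k≢j ∎

      sum-entry : ∀ a b → expand₂ a b ≈ sum λ j → sum (entry a b j)
      sum-entry a b = sum-cong-≋ λ j → begin
        sign (toℕ j) * a j * sum (λ j′ → sign (toℕ j′) * b (punchIn j j′) * D (punchIn j ∘ punchIn j′))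
          ≈⟨ *-distribˡ-sum (sign (toℕ j) * a j) (λ j′ → sign (toℕ j′) * b (punchIn j j′) * D (punchIn j ∘ punchIn j′)) ⟩
        sum (λ j′ → sign (toℕ j) * a j * (sign (toℕ j′) * b (punchIn j j′) * D (punchIn j ∘ punchIn j′)))
          ≈⟨ sum-cong-≋ (entry-punchIn a b j) ⟨
        sum (entry a b j ∘ punchIn j)
          ≈⟨ +-identityˡ _ ⟨
        0# + sum (entry a b j ∘ punchIn j)
          ≈⟨ +-congʳ (entry-diagonal a b j) ⟨
        entry a b j j + sum (entry a b j ∘ punchIn j)
          ≈⟨ sum-remove (entry a b j) ⟨
        sum (entry a b j) ∎

    expand₂-swap : ∀ a b → expand₂ a b ≈ - expand₂ b a
    expand₂-swap a b = begin
      expand₂ a b                             ≈⟨ sum-entry a b ⟩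
      (sum λ j → sum (entry a b j))           ≈⟨ ∑-comm (entry a b) ⟩
      (sum λ k → sum λ j → entry a b j k)     ≈⟨ sum-cong-≋ (λ k → sum-cong-≋ λ j → flip a b j k) ⟩
      (sum λ k → sum λ j → - 1# * entry b a k j)
        ≈⟨ sum-cong-≋ (λ k → sym (*-distribˡ-sum (- 1#) (entry b a k))) ⟩
      (sum λ k → - 1# * sum (entry b a k))    ≈⟨ *-distribˡ-sum (- 1#) (λ k → sum (entry b a k)) ⟨
      - 1# * (sum λ k → sum (entry b a k))    ≈⟨ *-congˡ (sum-entry b a) ⟨
      - 1# * expand₂ b a                      ≈⟨ solve 1 (λ x → :- :1 :* x := :- x) refl _ ⟩
      - expand₂ b a                           ∎
      where
      flip : ∀ a b j k → entry a b j k ≈ - 1# * entry b a k j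
      flip a b j k = trans (entry-swap a b j k) (solve 1 (λ x → :- x := :- :1 :* x) refl _)

    -- Antisymmetry gives x = - x, and 2 is invertible.
    expand₂-diagonal : ∀ a → expand₂ a a ≈ 0#
    expand₂-diagonal a = begin
      x             ≈⟨ solve 1 (λ x → x := con ½ :* (x :+ x)) refl x ⟩
      _ * (x + x)   ≈⟨ *-congˡ (+-congˡ (expand₂-swap a a)) ⟩
      _ * (x - x)   ≈⟨ solve 1 (λ x → con ½ :* (x :- x) := :0) refl x ⟩
      0#            ∎
      where x = expand₂ a a

  minor : ∀ {n} → (Fin n → Vector Carrier (suc (suc n))) → (Fin n → Fin (suc (suc n))) → Carrier
  minor {n} r σ = det n (λ i k → r i (σ k))

  minor-cong : ∀ {n} (r : Fin n → Vector Carrier (suc (suc n))) {σ τ} → σ ≗ τ → minor r σ ≈ minor r τ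
  minor-cong {n} r σ≗τ = det-cong n (λ i k → reflexive (≡.cong (r i) (σ≗τ k)))

  expand-cong : ∀ {n} {a b : Vector Carrier (suc n)} {r q : Fin n → Vector Carrier (suc n)} →
    (∀ j → a j ≈ b j) → (∀ i j → r i j ≈ q i j) → expand a r ≈ expand b q
  expand-cong {n} a≈b r≈q = sum-cong-≋ λ j →
    *-cong (*-congˡ {x = sign (toℕ j)} (a≈b j)) (det-cong n λ i k → r≈q i (punchIn j k))

  expand₂-linear : ∀ {n} (r : Fin n → Vector Carrier (suc (suc n))) x a b d →
    expand₂ (minor r) (minor-cong r) a (λ j → x * b j + d j)
      ≈ x * expand₂ (minor r) (minor-cong r) a b + expand₂ (minor r) (minor-cong r) a d
  expand₂-linear r x a b d = begin
    (sum λ j → α j * sum λ j′ → sign (toℕ j′) * (x * b (punchIn j j′) + d (punchIn j j′)) * μ j j′)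
      ≈⟨ sum-cong-≋ (λ j → *-congˡ {x = α j} (begin
        (sum λ j′ → sign (toℕ j′) * (x * b (punchIn j j′) + d (punchIn j j′)) * μ j j′)
          ≈⟨ sum-cong-≋ (λ j′ → solve 5 (λ s x b d m → s :* (x :* b :+ d) :* m := x :* (s :* b :* m) :+ s :* d :* m) refl
               (sign (toℕ j′)) x (b (punchIn j j′)) (d (punchIn j j′)) (μ j j′)) ⟩
        (sum λ j′ → x * β j j′ + δ j j′)          ≈⟨ ∑-distrib-+ (λ j′ → x * β j j′) (δ j) ⟩
        (sum λ j′ → x * β j j′) + sum (δ j)       ≈⟨ +-congʳ (sym (*-distribˡ-sum x (β j))) ⟩
        x * sum (β j) + sum (δ j)                 ∎)) ⟩
    (sum λ j → α j * (x * sum (β j) + sum (δ j)))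
      ≈⟨ sum-cong-≋ (λ j → solve 4 (λ a x b d → a :* (x :* b :+ d) := x :* (a :* b) :+ a :* d) refl
           (α j) x (sum (β j)) (sum (δ j))) ⟩
    (sum λ j → x * (α j * sum (β j)) + α j * sum (δ j))
      ≈⟨ ∑-distrib-+ (λ j → x * (α j * sum (β j))) (λ j → α j * sum (δ j)) ⟩
    (sum λ j → x * (α j * sum (β j))) + (sum λ j → α j * sum (δ j))
      ≈⟨ +-congʳ (sym (*-distribˡ-sum x (λ j → α j * sum (β j)))) ⟩
    x * (sum λ j → α j * sum (β j)) + (sum λ j → α j * sum (δ j)) ∎
    where
    α : _ → Carrier
    α j = sign (toℕ j) * a j
    μ β δ : _ → _ → Carrier
    μ j j′ = minor r (punchIn j ∘ punchIn j′)
    β j j′ = sign (toℕ j′) * b (punchIn j j′) * μ j j′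
    δ j j′ = sign (toℕ j′) * d (punchIn j j′) * μ j j′

  -- The row after a is moved to the top, where the induction hypothesis
  -- applies to the minors, which have one row fewer.
  expand-add-multiples : ∀ {n} (a : Vector Carrier (suc n)) (x : Vector Carrier n) r →
    expand a (λ i j → x i * a j + r i j) ≈ expand a r
  expand-add-multiples {zero}  a x r = refl
  expand-add-multiples {suc n} a x r = begin
    S q a (λ j → x zero * a j + r zero j)     ≈⟨ expand₂-linear q (x zero) a a (r zero) ⟩
    x zero * S q a a + S q a (r zero)
      ≈⟨ +-cong (*-congˡ (expand₂-diagonal (minor q) (minor-cong q) a)) (expand₂-swap (minor q) (minor-cong q) a (r zero)) ⟩
    x zero * 0# + - S q (r zero) a
      ≈⟨ +-congˡ (-‿cong (sum-cong-≋ λ j → *-congˡ {x = sign (toℕ j) * r zero j}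
           (expand-add-multiples (λ k → a (punchIn j k)) (x ∘ suc) (λ i k → r (suc i) (punchIn j k))))) ⟩
    x zero * 0# + - S (r ∘ suc) (r zero) a
      ≈⟨ solve 2 (λ x y → x :* :0 :+ y := y) refl _ _ ⟩
    - S (r ∘ suc) (r zero) a
      ≈⟨ expand₂-swap (minor (r ∘ suc)) (minor-cong (r ∘ suc)) a (r zero) ⟨
    S (r ∘ suc) a (r zero)                    ∎
    where
    S : (Fin n → Vector Carrier (suc (suc n))) → (a b : Vector Carrier (suc (suc n))) → Carrier
    S r = expand₂ (minor r) (minor-cong r)
    q : Fin n → Vector Carrier (suc (suc n))
    q i j = x (suc i) * a j + r (suc i) j

  -- The top row of the product is `L₀` times the top row of `U`. Multiples of that row of `U` can
  -- be cleared from the rows below, which leaves a product with the smaller triangular block;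
  -- induction applies to it inside each minor.
  det-lower* : ∀ n (L U : Matrix n) → (∀ i m → toℕ i ℕ.< toℕ m → L i m ≈ 0#) →
    det n (λ i j → sum λ m → L i m * U m j) ≈ product (λ i → L i i) * det n U
  det-lower* zero    L U L≈0 = solve 0 (:1 := :1 :* :1) refl
  det-lower* (suc n) L U L≈0 = begin
    expand (λ j → L₀ * U zero j + sum λ m → L zero (suc m) * U (suc m) j)
           (λ i j → L (suc i) zero * U zero j + q i j)
      ≈⟨ expand-cong {r = λ i j → L (suc i) zero * U zero j + q i j}
           (λ j → +-congˡ {x = L₀ * U zero j} (sum-zero λ m → trans (*-congʳ (L≈0 zero (suc m) (s≤s z≤n))) (zeroˡ (U (suc m) j))))
           (λ _ _ → refl) ⟩
    expand (λ j → L₀ * U zero j + 0#) (λ i j → L (suc i) zero * U zero j + q i j)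
      ≈⟨ sum-cong-≋ (λ j → solve 4 (λ s l u d → s :* (l :* u :+ :0) :* d := l :* (s :* u :* d)) refl
           (sign (toℕ j)) L₀ (U zero j) (minor₀ j)) ⟩
    sum (λ j → L₀ * (sign (toℕ j) * U zero j * minor₀ j))
      ≈⟨ *-distribˡ-sum L₀ (λ j → sign (toℕ j) * U zero j * minor₀ j) ⟨
    L₀ * expand (U zero) (λ i j → L (suc i) zero * U zero j + q i j)
      ≈⟨ *-congˡ (expand-add-multiples (U zero) (λ i → L (suc i) zero) q) ⟩
    L₀ * expand (U zero) q
      ≈⟨ *-congˡ (sum-cong-≋ λ j → trans
           (*-congˡ {x = sign (toℕ j) * U zero j} (det-lower* n (λ i m → L (suc i) (suc m)) (λ m k → U (suc m) (punchIn j k)) (λ i m i<m → L≈0 (suc i) (suc m) (s≤s i<m))))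
           (solve 4 (λ s u p d → s :* u :* (p :* d) := p :* (s :* u :* d)) refl
             (sign (toℕ j)) (U zero j) P (det n (λ i k → U (suc i) (punchIn j k))))) ⟩
    L₀ * sum (λ j → P * (sign (toℕ j) * U zero j * det n (λ i k → U (suc i) (punchIn j k))))
      ≈⟨ *-congˡ (*-distribˡ-sum P (λ j → sign (toℕ j) * U zero j * det n (λ i k → U (suc i) (punchIn j k)))) ⟨
    L₀ * (P * det (suc n) U)
      ≈⟨ *-assoc _ _ _ ⟨
    L₀ * P * det (suc n) U ∎
    where
    L₀ = L zero zero
    P  = product (λ i → L (suc i) (suc i))
    q : Fin n → Vector Carrier (suc n)
    q i j = sum λ m → L (suc i) (suc m) * U (suc m) j
    minor₀ : Fin (suc n) → Carrier
    minor₀ j = det n (λ i k → L (suc i) zero * U zero (punchIn j k) + q i (punchIn j k))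

  -- The expansion runs along the first row, while an upper triangular matrix has its zeros down the
  -- first column: each minor that keeps this column has to be shown to vanish.
  det-zero-column : ∀ n (M : Matrix (suc n)) → (∀ i → M i zero ≈ 0#) → det (suc n) M ≈ 0#
  det-zero-column n M M≈0 = sum-zero (term n M M≈0)
    where
    term : ∀ n (M : Matrix (suc n)) → (∀ i → M i zero ≈ 0#) → ∀ j →
      sign (toℕ j) * M zero j * det n (λ i k → M (suc i) (punchIn j k)) ≈ 0#
    term n       M M≈0 zero    = begin
      1# * M zero zero * det n (λ i k → M (suc i) (suc k))   ≈⟨ *-congʳ (*-congˡ (M≈0 zero)) ⟩
      1# * 0# * det n (λ i k → M (suc i) (suc k))           ≈⟨ solve 1 (λ x → :1 :* :0 :* x := :0) refl _ ⟩
      0#                     ∎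
    term (suc n) M M≈0 (suc j) =
      trans (*-congˡ (det-zero-column n (λ i k → M (suc i) (punchIn (suc j) k)) (λ i → M≈0 (suc i)))) (zeroʳ _)

  det-upper : ∀ n (U : Matrix n) → (∀ i j → toℕ j ℕ.< toℕ i → U i j ≈ 0#) →
    det n U ≈ product (λ i → U i i)
  det-upper zero    U U≈0 = refl
  det-upper (suc n) U U≈0 = begin
    1# * U zero zero * det n (λ i k → U (suc i) (suc k))
      + sum {n} (λ j → sign (toℕ (suc j)) * U zero (suc j) * det n (λ i k → U (suc i) (punchIn (suc j) k)))
      ≈⟨ +-cong (*-cong (*-identityˡ _) (det-upper n (λ i k → U (suc i) (suc k)) (λ i j j<i → U≈0 (suc i) (suc j) (s≤s j<i))))
                (sum-zero (rest n U U≈0)) ⟩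
    U zero zero * product (λ i → U (suc i) (suc i)) + 0#
      ≈⟨ +-identityʳ _ ⟩
    U zero zero * product (λ i → U (suc i) (suc i)) ∎
    where
    rest : ∀ n (U : Matrix (suc n)) → (∀ i j → toℕ j ℕ.< toℕ i → U i j ≈ 0#) → ∀ (j : Fin n) →
      sign (toℕ (suc j)) * U zero (suc j) * det n (λ i k → U (suc i) (punchIn (suc j) k)) ≈ 0#
    rest (suc n) U U≈0 j =
      trans (*-congˡ (det-zero-column n (λ i k → U (suc i) (punchIn (suc j) k)) (λ i → U≈0 (suc i) zero (s≤s z≤n)))) (zeroʳ _)

-- Finite sums and Pochhammer symbols.

module RangeSums {c ℓ : Level} (A : CommutativeℚAlgebra c ℓ) where
  open CommutativeℚAlgebra A hiding (zero)
  open SemiringSum semiring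

  Σ< : ℕ → (ℕ → Carrier) → Carrier
  Σ< n g = sum {n} (λ i → g (toℕ i))

  Σ<-cong : ∀ n {g h : ℕ → Carrier} → (∀ i → g i ≈ h i) → Σ< n g ≈ Σ< n h
  Σ<-cong n g≈h = sum-cong-≋ {n} (λ i → g≈h (toℕ i))

  Σ<-zero : ∀ n {g : ℕ → Carrier} → (∀ i → g i ≈ 0#) → Σ< n g ≈ 0#
  Σ<-zero n g≈0 = trans (Σ<-cong n g≈0) (sum-replicate-zero n)

  Σ<-+ : ∀ n (g h : ℕ → Carrier) → Σ< n (λ i → g i + h i) ≈ Σ< n g + Σ< n h
  Σ<-+ n g h = ∑-distrib-+ {n} (λ i → g (toℕ i)) (λ i → h (toℕ i))

  Σ<-* : ∀ n x (g : ℕ → Carrier) → Σ< n (λ i → x * g i) ≈ x * Σ< n g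
  Σ<-* n x g = sym (*-distribˡ-sum {n} x (λ i → g (toℕ i)))

  Σ<-last : ∀ n (g : ℕ → Carrier) → Σ< (suc n) g ≈ Σ< n g + g n
  Σ<-last = RangeFold.sum-last +-monoid

module PochhammerSymbol {c ℓ : Level} (A : CommutativeℚAlgebra c ℓ) where
  open CommutativeℚAlgebra A hiding (zero)
  open Series A

  pochhammer-last : ∀ a m → pochhammer a (suc m) ≈ pochhammer a m * (a + ⟦ m ⟧)
  pochhammer-last a m = RangeFold.sum-last *-monoid m (λ i → a + ⟦ i ⟧)

-- Column operations as spans of sequences.

module ColumnSpan {c ℓ : Level} (A : CommutativeℚAlgebra c ℓ) where
  open CommutativeℚAlgebra A hiding (zero)
  open Series A
  open Solver A
  open Determinant A
  open RangeSums A
  open SemiringSum semiring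
  open MonoidSum *-commutativeMonoid using () renaming (sum to product; sum-cong-≋ to product-cong)
  open SetoidReasoning setoid

  Sequence : Set c
  Sequence = ℕ → Carrier

  -- Membership is inductive, so that changes of generators and index shifts act by recursion on
  -- derivations; coordinates are extracted only for the determinant.
  data Span (K : ℕ → Sequence) (j : ℕ) : Sequence → Set (c ⊔ ℓ) where
    generator : ∀ {n} → n < j → Span K j (K n)
    null      : Span K j (λ _ → 0#)
    combine   : ∀ x {u v} → Span K j u → Span K j v → Span K j (λ i → x * u i + v i)
    respects  : ∀ {u v} → (∀ i → u i ≈ v i) → Span K j u → Span K j v

  -- w is x times the j-th generator modulo the earlier ones.
  record Leads (K : ℕ → Sequence) (j : ℕ) (x : Carrier) (w : Sequence) : Set (c ⊔ ℓ) where
    constructor leads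
    field
      {rest}   : Sequence
      rest∈    : Span K j rest
      equation : ∀ i → w i ≈ x * K j i + rest i

  module _ {K : ℕ → Sequence} where

    Span-weaken : ∀ {j k w} → j ≤ k → Span K j w → Span K k w
    Span-weaken j≤k (generator n<j)  = generator (ℕ.<-≤-trans n<j j≤k)
    Span-weaken j≤k null             = null
    Span-weaken j≤k (combine x p q)  = combine x (Span-weaken j≤k p) (Span-weaken j≤k q)
    Span-weaken j≤k (respects eq p)  = respects eq (Span-weaken j≤k p)

    Span-+ : ∀ {j u v} → Span K j u → Span K j v → Span K j (λ i → u i + v i)
    Span-+ p q = respects (λ i → +-congʳ (*-identityˡ _)) (combine 1# p q)

    Span-* : ∀ {j u} x → Span K j u → Span K j (λ i → x * u i)
    Span-* x p = respects (λ i → +-identityʳ _) (combine x p null)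

    Leads⇒Span : ∀ {j x w} → Leads K j x w → Span K (suc j) w
    Leads⇒Span {j} {x} (leads p eq) = respects (λ i → sym (eq i))
      (combine x (generator (ℕ.n<1+n j)) (Span-weaken (ℕ.n≤1+n j) p))

    Leads-respects : ∀ {j x y u v} → x ≈ y → (∀ i → u i ≈ v i) → Leads K j x u → Leads K j y v
    Leads-respects x≈y u≈v (leads p eq) =
      leads p (λ i → trans (sym (u≈v i)) (trans (eq i) (+-congʳ (*-congʳ x≈y))))

    Leads-+ : ∀ {j x u v} → Leads K j x u → Span K j v → Leads K j x (λ i → u i + v i)
    Leads-+ (leads p eq) q = leads (Span-+ p q) (λ i → trans (+-congʳ (eq i)) (+-assoc _ _ _))

    Leads-* : ∀ {j x u} y → Leads K j x u → Leads K j (y * x) (λ i → y * u i)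
    Leads-* y (leads p eq) = leads (Span-* y p) (λ i → trans (*-congˡ (eq i))
      (solve 4 (λ y x k r → y :* (x :* k :+ r) := y :* x :* k :+ y :* r) refl _ _ _ _))

  Span-map : ∀ {K L : ℕ → Sequence} {j k w} → (∀ n → n < j → Span L k (K n)) → Span K j w → Span L k w
  Span-map K∈ (generator n<j) = K∈ _ n<j
  Span-map K∈ null            = null
  Span-map K∈ (combine x p q) = combine x (Span-map K∈ p) (Span-map K∈ q)
  Span-map K∈ (respects eq p) = respects eq (Span-map K∈ p)

  -- Composition of two triangular changes of generators: the leading coefficients multiply, and the
  -- earlier generators stay among the earlier ones.
  Leads-trans : ∀ {K L : ℕ → Sequence} {x j w} {y : ℕ → Carrier} → (∀ n → Leads L n (y n) (K n)) →
    Leads K j x w → Leads L j (x * y j) w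
  Leads-trans {x = x} {j} K-leads (leads p eq) =
    Leads-respects refl (λ i → sym (eq i))
      (Leads-+ (Leads-* x (K-leads j)) (Span-map (λ n n<j → Span-weaken n<j (Leads⇒Span (K-leads n))) p))

  δ : ℕ → ℕ → Carrier
  δ zero    zero    = 1#
  δ zero    (suc m) = 0#
  δ (suc n) zero    = 0#
  δ (suc n) (suc m) = δ n m

  δ-diagonal : ∀ n → δ n n ≈ 1#
  δ-diagonal zero    = refl
  δ-diagonal (suc n) = δ-diagonal n

  δ-< : ∀ {n m} → n < m → δ n m ≈ 0#
  δ-< {zero}  (s≤s _)   = refl
  δ-< {suc n} (s≤s n<m) = δ-< n<m

  Σ<-δ : ∀ {n N} → n < N → ∀ (g : ℕ → Carrier) → Σ< N (λ m → δ n m * g m) ≈ g n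
  Σ<-δ {zero}  {suc N} _         g = trans (+-cong (*-identityˡ _) (Σ<-zero N (λ m → zeroˡ (g (suc m))))) (+-identityʳ _)
  Σ<-δ {suc n} {suc N} (s≤s n<N) g = trans (+-congʳ (zeroˡ _)) (trans (+-identityˡ _) (Σ<-δ n<N (g ∘ suc)))

  module _ {K : ℕ → Sequence} where

    -- Allowing every length N ≥ j lets columns that are spanned by different numbers of generators
    -- be expanded at the common size of the matrix.
    record Coordinates (j : ℕ) (w : Sequence) : Set (c ⊔ ℓ) where
      field
        coeff   : ℕ → Carrier
        coeff≈0 : ∀ n → j ≤ n → coeff n ≈ 0#
        expands : ∀ N → j ≤ N → ∀ i → w i ≈ Σ< N (λ m → coeff m * K m i)

    open Coordinates

    coordinates : ∀ {j w} → Span K j w → Coordinates j w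
    coordinates (generator {n} n<j) .coeff          = δ n
    coordinates (generator {n} n<j) .coeff≈0 m j≤m  = δ-< (ℕ.<-≤-trans n<j j≤m)
    coordinates (generator {n} n<j) .expands N j≤N i = sym (Σ<-δ (ℕ.<-≤-trans n<j j≤N) (λ m → K m i))
    coordinates null .coeff _       = 0#
    coordinates null .coeff≈0 _ _   = refl
    coordinates null .expands N _ i = sym (Σ<-zero N (λ m → zeroˡ (K m i)))
    coordinates (combine x p q) .coeff n       = x * coordinates p .coeff n + coordinates q .coeff n
    coordinates (combine x p q) .coeff≈0 n j≤n =
      trans (+-cong (*-congˡ (coordinates p .coeff≈0 n j≤n)) (coordinates q .coeff≈0 n j≤n))
            (solve 1 (λ x → x :* :0 :+ :0 := :0) refl x)
    coordinates (combine x {u} {v} p q) .expands N j≤N i = begin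
      x * u i + v i
        ≈⟨ +-cong (*-congˡ (coordinates p .expands N j≤N i)) (coordinates q .expands N j≤N i) ⟩
      x * Σ< N (λ m → a m * K m i) + Σ< N (λ m → b m * K m i)
        ≈⟨ +-congʳ (Σ<-* N x (λ m → a m * K m i)) ⟨
      Σ< N (λ m → x * (a m * K m i)) + Σ< N (λ m → b m * K m i)
        ≈⟨ Σ<-+ N (λ m → x * (a m * K m i)) (λ m → b m * K m i) ⟨
      Σ< N (λ m → x * (a m * K m i) + b m * K m i)
        ≈⟨ Σ<-cong N (λ m → solve 4 (λ x a k b → x :* (a :* k) :+ b :* k := (x :* a :+ b) :* k) refl x (a m) (K m i) (b m)) ⟩
      Σ< N (λ m → (x * a m + b m) * K m i) ∎
      where
      a = coordinates p .coeff
      b = coordinates q .coeff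
    coordinates (respects eq p) .coeff             = coordinates p .coeff
    coordinates (respects eq p) .coeff≈0           = coordinates p .coeff≈0
    coordinates (respects eq p) .expands N j≤N i   = trans (sym (eq i)) (coordinates p .expands N j≤N i)

    -- The matrix factors into the values of the generators, lower triangular by their order of
    -- vanishing, and the coordinates of the columns, upper triangular with diagonal `x`.
    det-leads : (M : ℕ → Sequence) (x : ℕ → Carrier) →
      (∀ n i → i < n → K n i ≈ 0#) → (∀ j → Leads K j (x j) (M j)) →
      ∀ N → det N (λ i j → M (toℕ j) (toℕ i)) ≈ product {N} (λ i → K (toℕ i) (toℕ i) * x (toℕ i))
    det-leads M x K≈0 M-leads N = begin
      det N (λ i j → M (toℕ j) (toℕ i))
        ≈⟨ det-cong N (λ i j → M-expands j (toℕ i)) ⟩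
      det N (λ i j → sum {N} λ m → L i m * U m j)
        ≈⟨ det-lower* N L U (λ i m → K≈0 (toℕ m) (toℕ i)) ⟩
      product (λ i → L i i) * det N U
        ≈⟨ *-congˡ (det-upper N U (λ m j j<m → trans (+-cong (*-congˡ (δ-< j<m)) (coords j .coeff≈0 _ (ℕ.<⇒≤ j<m)))
             (solve 1 (λ x → x :* :0 :+ :0 := :0) refl _))) ⟩
      product (λ i → L i i) * product (λ i → U i i)
        ≈⟨ MonoidSum.∑-distrib-+ *-commutativeMonoid {N} (λ i → L i i) (λ i → U i i) ⟨
      product (λ i → L i i * U i i)
        ≈⟨ product-cong {N} (λ i → *-congˡ (trans (+-cong (*-congˡ (δ-diagonal (toℕ i))) (coords i .coeff≈0 _ ℕ.≤-refl))
             (solve 1 (λ x → x :* :1 :+ :0 := x) refl _))) ⟩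
      product {N} (λ i → K (toℕ i) (toℕ i) * x (toℕ i)) ∎
      where
      coords : ∀ (j : Fin N) → Coordinates (toℕ j) (Leads.rest (M-leads (toℕ j)))
      coords j = coordinates (Leads.rest∈ (M-leads (toℕ j)))
      L U : Matrix N
      L i m = K (toℕ m) (toℕ i)
      U m j = x (toℕ j) * δ (toℕ j) (toℕ m) + coords j .coeff (toℕ m)
      M-expands : ∀ j i → M (toℕ j) i ≈ Σ< N (λ m → K m i * (x (toℕ j) * δ (toℕ j) m + coords j .coeff m))
      M-expands j i = begin
        M (toℕ j) i
          ≈⟨ Leads.equation (M-leads (toℕ j)) i ⟩
        x (toℕ j) * K (toℕ j) i + Leads.rest (M-leads (toℕ j)) i
          ≈⟨ +-cong (*-congˡ (sym (Σ<-δ (Fin.toℕ<n j) (λ m → K m i)))) (coords j .expands N (ℕ.<⇒≤ (Fin.toℕ<n j)) i) ⟩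
        x (toℕ j) * Σ< N (λ m → δ (toℕ j) m * K m i) + Σ< N (λ m → coords j .coeff m * K m i)
          ≈⟨ +-congʳ (Σ<-* N (x (toℕ j)) (λ m → δ (toℕ j) m * K m i)) ⟨
        Σ< N (λ m → x (toℕ j) * (δ (toℕ j) m * K m i)) + Σ< N (λ m → coords j .coeff m * K m i)
          ≈⟨ Σ<-+ N (λ m → x (toℕ j) * (δ (toℕ j) m * K m i)) (λ m → coords j .coeff m * K m i) ⟨
        Σ< N (λ m → x (toℕ j) * (δ (toℕ j) m * K m i) + coords j .coeff m * K m i)
          ≈⟨ Σ<-cong N (λ m → solve 4 (λ x d k e → x :* (d :* k) :+ e :* k := k :* (x :* d :+ e)) refl
               (x (toℕ j)) (δ (toℕ j) m) (K m i) (coords j .coeff m)) ⟩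
        Σ< N (λ m → K m i * (x (toℕ j) * δ (toℕ j) m + coords j .coeff m)) ∎

-- Derivatives of secᵗ tanᵐ and x secᵗ tanᵐ, and splitting off the Pochhammer symbols.

module Derivatives {c ℓ : Level} (A : CommutativeℚAlgebra c ℓ) (t : CommutativeℚAlgebra.Carrier A) where
  open CommutativeℚAlgebra A hiding (zero)
  open Series A
  open Solver A
  open Scalars A
  open RangeSums A
  open ColumnSpan A
  open PochhammerSymbol A
  open SetoidReasoning setoid

  -- e k m is the k-th derivative of secᵗ tanᵐ at 0.
  e : ℕ → ℕ → Carrier
  e zero    zero    = 1#
  e zero    (suc m) = 0#
  e (suc k) m       = (t + ⟦ m ⟧) * e k (suc m) + ⟦ m ⟧ * e k (pred m)

  -- y k m is the k-th derivative of x secᵗ tanᵐ at 0.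
  y : ℕ → ℕ → Carrier
  y zero    m = 0#
  y (suc k) m = ⟦ suc k ⟧ * e k m

  -- The function tan has a simple zero at 0, so F tanᵐ has order m. This bound justifies the
  -- truncation of every series in tan below.
  e-vanishes : ∀ {k m} → k < m → e k m ≈ 0#
  e-vanishes {zero}  {suc m} _         = refl
  e-vanishes {suc k} {suc m} (s≤s k<m) = begin
    (t + ⟦ suc m ⟧) * e k (suc (suc m)) + ⟦ suc m ⟧ * e k m
      ≈⟨ +-cong (*-congˡ (e-vanishes (ℕ.m≤n⇒m≤1+n (ℕ.m≤n⇒m≤1+n k<m)))) (*-congˡ (e-vanishes k<m)) ⟩
    (t + ⟦ suc m ⟧) * 0# + ⟦ suc m ⟧ * 0#
      ≈⟨ solve 2 (λ a b → a :* :0 :+ b :* :0 := :0) refl _ _ ⟩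
    0# ∎

  e-diagonal : ∀ k → e k k ≈ ⟦ k ! ⟧
  e-diagonal zero    = sym (+-identityʳ 1#)
  e-diagonal (suc k) = begin
    (t + ⟦ suc k ⟧) * e k (suc (suc k)) + ⟦ suc k ⟧ * e k k
      ≈⟨ +-cong (*-congˡ (e-vanishes (ℕ.m≤n⇒m≤1+n (ℕ.n<1+n k)))) (*-congˡ (e-diagonal k)) ⟩
    (t + ⟦ suc k ⟧) * 0# + ⟦ suc k ⟧ * ⟦ k ! ⟧
      ≈⟨ solve 2 (λ a b → a :* :0 :+ b := b) refl _ _ ⟩
    ⟦ suc k ⟧ * ⟦ k ! ⟧
      ≈⟨ ⟦⟧-* (suc k) (k !) ⟨
    ⟦ suc k ! ⟧ ∎

  mutual
    -- F is even and tan is odd, so F tanᵐ has the parity of m.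
    e-even-odd : ∀ k q → e (dbl k) (suc (dbl q)) ≈ 0#
    e-even-odd zero    q = refl
    e-even-odd (suc k) q = trans (+-cong (*-congˡ (e-odd-even k (suc q))) (*-congˡ (e-odd-even k q)))
      (solve 2 (λ a b → a :* :0 :+ b :* :0 := :0) refl _ _)

    e-odd-even : ∀ k q → e (suc (dbl k)) (dbl q) ≈ 0#
    e-odd-even k zero    = trans (+-congʳ (*-congˡ (e-even-odd k 0)))
      (solve 2 (λ a b → a :* :0 :+ :0 :* b := :0) refl _ _)
    e-odd-even k (suc q) = trans (+-cong (*-congˡ (e-even-odd k (suc q))) (*-congˡ (e-even-odd k q)))
      (solve 2 (λ a b → a :* :0 :+ b :* :0 := :0) refl _ _)

  y-even-even : ∀ k q → y (dbl k) (dbl q) ≈ 0#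
  y-even-even zero    q = refl
  y-even-even (suc k) q = trans (*-congˡ (e-odd-even k q)) (zeroʳ _)

  -- Differentiating x F tanᵐ gives the recurrence of `e` with the extra summand F tanᵐ. In this
  -- form an expression can be compared with `y` by induction on the order.
  y-step : ∀ k m → y (suc k) m ≈ (t + ⟦ m ⟧) * y k (suc m) + ⟦ m ⟧ * y k (pred m) + e k m
  y-step zero    m = solve 3 (λ t m x → (:1 :+ :0) :* x := (t :+ m) :* :0 :+ m :* :0 :+ x) refl t ⟦ m ⟧ (e zero m)
  y-step (suc k) m = solve 5 (λ t m k x x′ → let e′ = (t :+ m) :* x :+ m :* x′ in
      (:1 :+ (:1 :+ k)) :* e′ := (t :+ m) :* ((:1 :+ k) :* x) :+ m :* ((:1 :+ k) :* x′) :+ e′)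
    refl t ⟦ m ⟧ ⟦ k ⟧ (e k (suc m)) (e k (pred m))

  -- E m and B m list the derivatives of even order at 0 of secᵗ tanᵐ and (1 + x) secᵗ tanᵐ.
  E B : ℕ → Sequence
  E m i = e (dbl i) m
  B m i = e (dbl i) m + y (dbl i) m

  -- For even m the part x F tanᵐ of `B m` is odd and drops out at even orders; for odd m the
  -- function F tanᵐ itself does.
  E∈B : ∀ m → Span B (suc m) (E m)
  E∈B m with parity m
  ... | inj₁ (q , ≡.refl) = respects
    (λ i → trans (+-congˡ (y-even-even i q)) (+-identityʳ _)) (generator (ℕ.n<1+n m))
  ... | inj₂ (q , ≡.refl) = respects (λ i → sym (e-even-odd i q)) null

  -- An index shift is a second derivative, and (x G)'' = x G'' + 2 G'. For G = F tanᵐ the part G''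
  -- reaches tanᵐ⁺², tanᵐ and tanᵐ⁻², while 2 G' gives multiples of `E (suc m)` and `E (pred m)`.
  -- Truncated predecessors are harmless, as they come with a factor 0.
  B-shift : ∀ m → Leads B (suc (suc m)) ((t + ⟦ m ⟧) * (t + ⟦ suc m ⟧)) (λ i → B m (suc i))
  B-shift m = leads
    (combine (a * ⟦ suc m ⟧) (generator (ℕ.m≤n⇒m≤1+n (ℕ.n<1+n m)))
    (combine (⟦ m ⟧ * b) (generator (s≤s (s≤s (ℕ.pred[n]≤n {m}))))
    (combine (⟦ m ⟧ * ⟦ pred m ⟧) (generator (s≤s (ℕ.≤-trans (ℕ.pred[n]≤n {pred m}) (ℕ.m≤n⇒m≤1+n (ℕ.pred[n]≤n {m})))))
    (combine (a + a) (E∈B (suc m))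
    (Span-* (⟦ m ⟧ + ⟦ m ⟧) (Span-weaken (s≤s (ℕ.m≤n⇒m≤1+n (ℕ.pred[n]≤n {m}))) (E∈B (pred m))))))))
    λ i → let k = dbl i in begin
      e (suc (suc k)) m + y (suc (suc k)) m
        ≈⟨ +-congˡ (begin
          y (suc (suc k)) m
            ≈⟨ y-step (suc k) m ⟩
          a * y (suc k) (suc m) + ⟦ m ⟧ * y (suc k) (pred m) + e (suc k) m
            ≈⟨ +-congʳ (+-cong (*-congˡ (y-step k (suc m))) (*-congˡ (y-step k (pred m)))) ⟩
          a * (a′ * y k (suc (suc m)) + ⟦ suc m ⟧ * y k m + e k (suc m))
            + ⟦ m ⟧ * (b * y k (suc (pred m)) + ⟦ pred m ⟧ * y k (pred (pred m)) + e k (pred m)) + e (suc k) m ∎) ⟩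
      e (suc (suc k)) m
        + (a * (a′ * y k (suc (suc m)) + ⟦ suc m ⟧ * y k m + e k (suc m))
          + ⟦ m ⟧ * (b * y k (suc (pred m)) + ⟦ pred m ⟧ * y k (pred (pred m)) + e k (pred m)) + e (suc k) m)
        ≈⟨ solve 16 (λ a a′ m m′ b p e₁ e₂ e₃ e₄ f₁ f₂ y₁ y₂ y₃ y₄ →
             a :* (a′ :* e₁ :+ m′ :* e₂) :+ m :* (b :* e₃ :+ p :* e₄)
               :+ (a :* (a′ :* y₁ :+ m′ :* y₂ :+ f₁) :+ m :* (b :* y₃ :+ p :* y₄ :+ f₂) :+ (a :* f₁ :+ m :* f₂))
             := a :* a′ :* (e₁ :+ y₁) :+ (a :* m′ :* (e₂ :+ y₂) :+ (m :* b :* (e₃ :+ y₃)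
               :+ (m :* p :* (e₄ :+ y₄) :+ ((a :+ a) :* f₁ :+ (m :+ m) :* f₂)))))
           refl a a′ ⟦ m ⟧ ⟦ suc m ⟧ b ⟦ pred m ⟧
             (e k (suc (suc m))) (e k m) (e k (suc (pred m))) (e k (pred (pred m))) (e k (suc m)) (e k (pred m))
             (y k (suc (suc m))) (y k m) (y k (suc (pred m))) (y k (pred (pred m))) ⟩
      a * a′ * B (suc (suc m)) i + (a * ⟦ suc m ⟧ * B m i + (⟦ m ⟧ * b * B (suc (pred m)) i
        + (⟦ m ⟧ * ⟦ pred m ⟧ * B (pred (pred m)) i + ((a + a) * E (suc m) i + (⟦ m ⟧ + ⟦ m ⟧) * E (pred m) i)))) ∎
    where
    a  = t + ⟦ m ⟧
    a′ = t + ⟦ suc m ⟧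
    b  = t + ⟦ pred m ⟧

  Span-shift : ∀ {j w} → Span B j w → Span B (suc (suc j)) (w ∘ suc)
  Span-shift (generator {n} n<j) = Span-weaken (s≤s (s≤s n<j)) (Leads⇒Span (B-shift n))
  Span-shift null                = null
  Span-shift (combine x p q)     = combine x (Span-shift p) (Span-shift q)
  Span-shift (respects eq p)     = respects (eq ∘ suc) (Span-shift p)

  Leads-shift : ∀ {j x w} → Leads B j x w →
    Leads B (suc (suc j)) (x * ((t + ⟦ j ⟧) * (t + ⟦ suc j ⟧))) (w ∘ suc)
  Leads-shift {j} {x} (leads p eq) = Leads-respects refl (λ i → sym (eq (suc i)))
    (Leads-+ (Leads-* x (B-shift j)) (Span-shift p))

  M : ℕ → Sequence
  M j i = e (j ℕ.+ dbl i) 0 + y (j ℕ.+ dbl i) 0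

  -- One derivative exchanges even and odd orders, so induction goes in steps of two from separate
  -- starts at 0 and 1.
  M-leads : ∀ j → Leads B j (pochhammer t j) (M j)
  M-leads zero          = leads null (λ i → solve 1 (λ x → x := :1 :* x :+ :0) refl (M 0 i))
  M-leads (suc zero)    = leads (E∈B 0) (λ i → let k = dbl i in
    trans (+-congˡ (y-step k 0))
      (solve 5 (λ t e₁ y₁ e₀ y₀ → (t :+ :0) :* e₁ :+ :0 :* e₀ :+ ((t :+ :0) :* y₁ :+ :0 :* y₀ :+ e₀)
          := (t :+ :0) :* :1 :* (e₁ :+ y₁) :+ e₀)
        refl t (e k 1) (y k 1) (e k 0) (y k 0)))
  M-leads (suc (suc j)) = Leads-respects
    (trans (sym (*-assoc _ _ _)) (sym (trans (pochhammer-last t (suc j)) (*-congʳ (pochhammer-last t j)))))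
    (λ i → reflexive (≡.cong (λ k → e k 0 + y k 0)
      (≡.trans (ℕ.+-suc j (suc (dbl i))) (≡.cong suc (ℕ.+-suc j (dbl i))))))
    (Leads-shift (M-leads j))

  -- Hypergeometric coefficients and their contiguity relation.

  evenInv oddInv : ℕ → Carrier
  evenInv n = inv (suc (dbl n))
  oddInv n  = inv (dbl n)

  oddInv-inverse : ∀ n → (⟦ n ⟧ + ⟦ n ⟧ + 1#) * oddInv n ≈ 1#
  oddInv-inverse n = trans (*-congʳ (trans (+-comm _ 1#) (+-congˡ (sym (⟦⟧-dbl n))))) (inv-inverse (dbl n))

  evenInv-inverse : ∀ n → (⟦ n ⟧ + ⟦ n ⟧ + 1# + 1#) * evenInv n ≈ 1#
  evenInv-inverse n = trans (*-congʳ (trans (+-comm _ 1#) (+-congˡ (trans (+-comm _ 1#) (+-congˡ (sym (⟦⟧-dbl n)))))))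
    (inv-inverse (suc (dbl n)))

  -- γ n k = (-1)ᵏ (n/2)ₖ ((n+1)/2)ₖ / ((n+1/2)ₖ k!), so that
  -- Σₖ γ n k z²ᵏ = ₂F₁(n/2, (n+1)/2; n+1/2; -z²).
  γ : ℕ → ℕ → Carrier
  γ n zero    = 1#
  γ n (suc k) = - (γ n k * ((⟦ n ⟧ + ⟦ k ⟧ + ⟦ k ⟧) * (⟦ n ⟧ + ⟦ k ⟧ + ⟦ k ⟧ + 1#)))
                * (evenInv k * oddInv (k ℕ.+ n))

  κ : ℕ → Carrier
  κ n = (⟦ suc n ⟧ * ⟦ suc n ⟧) * (oddInv n * oddInv (suc n))

  -- The common factor of γ n (suc k), γ (suc n) (suc k) and γ (suc (suc n)) k.
  ζ : ℕ → ℕ → Carrier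
  ζ n zero    = - (evenInv 0 * (oddInv n * oddInv (suc n)))
  ζ n (suc k) = - (ζ n k * ((⟦ n ⟧ + ⟦ k ⟧ + ⟦ k ⟧ + ⟦ 2 ⟧) * (⟦ n ⟧ + ⟦ k ⟧ + ⟦ k ⟧ + ⟦ 3 ⟧)))
                * (evenInv (suc k) * oddInv (suc (suc k) ℕ.+ n))

  oddInv-+-inverse : ∀ k n → (⟦ k ⟧ + ⟦ n ⟧ + (⟦ k ⟧ + ⟦ n ⟧) + 1#) * oddInv (k ℕ.+ n) ≈ 1#
  oddInv-+-inverse k n =
    trans (*-congʳ (+-congʳ (+-cong (sym (⟦⟧-+ k n)) (sym (⟦⟧-+ k n))))) (oddInv-inverse (k ℕ.+ n))

  -- The solver treats inverses as atoms; products equal to 1 are replaced, inserted or removed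
  -- between its calls by this lemma and the next.
  exchange : ∀ {u v u′ v′} x → u * v ≈ 1# → u′ * v′ ≈ 1# → x * (u * v) ≈ x * (u′ * v′)
  exchange x uv≈1 u′v′≈1 = *-congˡ (trans uv≈1 (sym u′v′≈1))

  cancel : ∀ {u v} x → u * v ≈ 1# → x * (u * v) ≈ x
  cancel x uv≈1 = trans (*-congˡ uv≈1) (*-identityʳ x)

  -- Here ζ n k is (-1)ᵏ⁺¹ (n+2)(n+3)⋯(n+2k+1) divided by 2·4⋯(2k+2) and by (2n+1)(2n+3)⋯(2n+2k+3).
  -- Working with multiples of `ζ` avoids quotients of the `γ 0 k`, which vanish for k > 0. The
  -- induction step trades the factor 2n+2k+3 for 2n+2k+5.
  γ≈ζ : ∀ n k → γ n (suc k) ≈ ⟦ n ⟧ * (⟦ n ⟧ + 1#) * (⟦ n ⟧ + ⟦ n ⟧ + ⟦ k ⟧ + ⟦ k ⟧ + ⟦ 3 ⟧) * ζ n k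
  γ≈ζ n zero = begin
    γ n 1
      ≈⟨ cancel _ (oddInv-inverse (suc n)) ⟨
    γ n 1 * ((1# + N + (1# + N) + 1#) * oddInv (suc n))
      ≈⟨ solve 4 (λ n i j k →
           :- (:1 :* ((n :+ :0 :+ :0) :* (n :+ :0 :+ :0 :+ :1))) :* (i :* j) :* ((:1 :+ n :+ (:1 :+ n) :+ :1) :* k)
           := n :* (n :+ :1) :* (n :+ n :+ :0 :+ :0 :+ :⟦ 3 ⟧) :* (:- (i :* (j :* k))))
         refl N (evenInv 0) (oddInv n) (oddInv (suc n)) ⟩
    N * (N + 1#) * (N + N + 0# + 0# + ⟦ 3 ⟧) * ζ n zero ∎
    where N = ⟦ n ⟧
  γ≈ζ n (suc k) = begin
    - (γ n (suc k) * factor) * (i * j)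
      ≈⟨ *-congʳ (-‿cong (*-congʳ (γ≈ζ n k))) ⟩
    - (N * (N + 1#) * (N + N + K + K + ⟦ 3 ⟧) * z * factor) * (i * j)
      ≈⟨ solve 6 (λ n k z f i j →
           :- (n :* (n :+ :1) :* (n :+ n :+ k :+ k :+ :⟦ 3 ⟧) :* z :* f) :* (i :* j)
           := :- (n :* (n :+ :1) :* z :* f) :* i :* ((:1 :+ k :+ n :+ (:1 :+ k :+ n) :+ :1) :* j))
         refl N K z factor i j ⟩
    - (N * (N + 1#) * z * factor) * i * ((1# + K + N + (1# + K + N) + 1#) * j)
      ≈⟨ exchange _ (oddInv-+-inverse (suc k) n) (oddInv-+-inverse (suc (suc k)) n) ⟩
    - (N * (N + 1#) * z * factor) * i * ((1# + (1# + K) + N + (1# + (1# + K) + N) + 1#) * j′)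
      ≈⟨ solve 5 (λ n k z i j →
           :- (n :* (n :+ :1) :* z :* ((n :+ (:1 :+ k) :+ (:1 :+ k)) :* (n :+ (:1 :+ k) :+ (:1 :+ k) :+ :1))) :* i
             :* ((:1 :+ (:1 :+ k) :+ n :+ (:1 :+ (:1 :+ k) :+ n) :+ :1) :* j)
           := n :* (n :+ :1) :* (n :+ n :+ (:1 :+ k) :+ (:1 :+ k) :+ :⟦ 3 ⟧)
             :* (:- (z :* ((n :+ k :+ k :+ :⟦ 2 ⟧) :* (n :+ k :+ k :+ :⟦ 3 ⟧))) :* (i :* j)))
         refl N K z i j′ ⟩
    N * (N + 1#) * (N + N + (1# + K) + (1# + K) + ⟦ 3 ⟧) * ζ n (suc k) ∎
    where
    N  = ⟦ n ⟧
    K  = ⟦ k ⟧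
    z  = ζ n k
    i  = evenInv (suc k)
    j  = oddInv (suc k ℕ.+ n)
    j′ = oddInv (suc (suc k) ℕ.+ n)
    factor = (N + (1# + K) + (1# + K)) * (N + (1# + K) + (1# + K) + 1#)

  γ-suc≈ζ : ∀ n k → γ (suc n) (suc k) ≈
    (⟦ n ⟧ + 1#) * (⟦ n ⟧ + ⟦ k ⟧ + ⟦ k ⟧ + ⟦ 2 ⟧) * (⟦ n ⟧ + ⟦ n ⟧ + 1#) * ζ n k
  γ-suc≈ζ n zero = begin
    γ (suc n) 1
      ≈⟨ cancel _ (oddInv-inverse n) ⟨
    γ (suc n) 1 * ((N + N + 1#) * oddInv n)
      ≈⟨ solve 4 (λ n i j k →
           :- (:1 :* ((:1 :+ n :+ :0 :+ :0) :* (:1 :+ n :+ :0 :+ :0 :+ :1))) :* (i :* k) :* ((n :+ n :+ :1) :* j)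
           := (n :+ :1) :* (n :+ :0 :+ :0 :+ :⟦ 2 ⟧) :* (n :+ n :+ :1) :* (:- (i :* (j :* k))))
         refl N (evenInv 0) (oddInv n) (oddInv (suc n)) ⟩
    (N + 1#) * (N + 0# + 0# + ⟦ 2 ⟧) * (N + N + 1#) * ζ n zero ∎
    where N = ⟦ n ⟧
  γ-suc≈ζ n (suc k) = begin
    - (γ (suc n) (suc k) * factor) * (i * oddInv (suc k ℕ.+ suc n))
      ≈⟨ *-cong (-‿cong (*-congʳ (γ-suc≈ζ n k)))
           (*-congˡ (reflexive (≡.cong (oddInv ∘ suc) (ℕ.+-suc k n)))) ⟩
    - ((N + 1#) * (N + K + K + ⟦ 2 ⟧) * (N + N + 1#) * z * factor) * (i * j)
      ≈⟨ solve 5 (λ n k z i j →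
           :- ((n :+ :1) :* (n :+ k :+ k :+ :⟦ 2 ⟧) :* (n :+ n :+ :1) :* z
             :* ((:1 :+ n :+ (:1 :+ k) :+ (:1 :+ k)) :* (:1 :+ n :+ (:1 :+ k) :+ (:1 :+ k) :+ :1))) :* (i :* j)
           := (n :+ :1) :* (n :+ (:1 :+ k) :+ (:1 :+ k) :+ :⟦ 2 ⟧) :* (n :+ n :+ :1)
             :* (:- (z :* ((n :+ k :+ k :+ :⟦ 2 ⟧) :* (n :+ k :+ k :+ :⟦ 3 ⟧))) :* (i :* j)))
         refl N K z i j ⟩
    (N + 1#) * (N + (1# + K) + (1# + K) + ⟦ 2 ⟧) * (N + N + 1#) * ζ n (suc k) ∎
    where
    N = ⟦ n ⟧
    K = ⟦ k ⟧
    z = ζ n k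
    i = evenInv (suc k)
    j = oddInv (suc (suc k) ℕ.+ n)
    factor = (1# + N + (1# + K) + (1# + K)) * (1# + N + (1# + K) + (1# + K) + 1#)

  γ-suc-suc≈ζ : ∀ n k → γ (suc (suc n)) k ≈
    - ((⟦ k ⟧ + ⟦ k ⟧ + ⟦ 2 ⟧) * (⟦ n ⟧ + ⟦ n ⟧ + 1#) * (⟦ n ⟧ + ⟦ n ⟧ + ⟦ 3 ⟧) * ζ n k)
  γ-suc-suc≈ζ n zero = begin
    1#
      ≈⟨ cancel 1# (evenInv-inverse 0) ⟨
    1# * ((0# + 0# + 1# + 1#) * i)
      ≈⟨ cancel _ (oddInv-inverse n) ⟨
    1# * ((0# + 0# + 1# + 1#) * i) * ((N + N + 1#) * j)
      ≈⟨ cancel _ (oddInv-inverse (suc n)) ⟨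
    1# * ((0# + 0# + 1# + 1#) * i) * ((N + N + 1#) * j) * ((1# + N + (1# + N) + 1#) * k)
      ≈⟨ solve 4 (λ n i j k →
           :1 :* ((:0 :+ :0 :+ :1 :+ :1) :* i) :* ((n :+ n :+ :1) :* j) :* ((:1 :+ n :+ (:1 :+ n) :+ :1) :* k)
           := :- ((:0 :+ :0 :+ :⟦ 2 ⟧) :* (n :+ n :+ :1) :* (n :+ n :+ :⟦ 3 ⟧) :* (:- (i :* (j :* k)))))
         refl N i j k ⟩
    - ((0# + 0# + ⟦ 2 ⟧) * (N + N + 1#) * (N + N + ⟦ 3 ⟧) * ζ n zero) ∎
    where
    N = ⟦ n ⟧
    i = evenInv 0
    j = oddInv n
    k = oddInv (suc n)
  γ-suc-suc≈ζ n (suc k) = begin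
    - (γ (suc (suc n)) k * factor) * (i * oddInv (k ℕ.+ suc (suc n)))
      ≈⟨ *-cong (-‿cong (*-congʳ (γ-suc-suc≈ζ n k)))
           (*-congˡ (reflexive (≡.cong oddInv (≡.trans (ℕ.+-suc k (suc n)) (≡.cong suc (ℕ.+-suc k n)))))) ⟩
    - (- ((K + K + ⟦ 2 ⟧) * (N + N + 1#) * (N + N + ⟦ 3 ⟧) * z) * factor) * (i * j)
      ≈⟨ solve 6 (λ n k z f i j →
           :- (:- ((k :+ k :+ :⟦ 2 ⟧) :* (n :+ n :+ :1) :* (n :+ n :+ :⟦ 3 ⟧) :* z) :* f) :* (i :* j)
           := (n :+ n :+ :1) :* (n :+ n :+ :⟦ 3 ⟧) :* z :* f :* j :* ((k :+ k :+ :1 :+ :1) :* i))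
         refl N K z factor i j ⟩
    (N + N + 1#) * (N + N + ⟦ 3 ⟧) * z * factor * j * ((K + K + 1# + 1#) * i)
      ≈⟨ exchange _ (evenInv-inverse k) (evenInv-inverse (suc k)) ⟩
    (N + N + 1#) * (N + N + ⟦ 3 ⟧) * z * factor * j * ((1# + K + (1# + K) + 1# + 1#) * i′)
      ≈⟨ solve 5 (λ n k z i j →
           (n :+ n :+ :1) :* (n :+ n :+ :⟦ 3 ⟧) :* z
             :* ((:1 :+ (:1 :+ n) :+ k :+ k) :* (:1 :+ (:1 :+ n) :+ k :+ k :+ :1)) :* j
             :* ((:1 :+ k :+ (:1 :+ k) :+ :1 :+ :1) :* i)
           := :- ((:1 :+ k :+ (:1 :+ k) :+ :⟦ 2 ⟧) :* (n :+ n :+ :1) :* (n :+ n :+ :⟦ 3 ⟧)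
             :* (:- (z :* ((n :+ k :+ k :+ :⟦ 2 ⟧) :* (n :+ k :+ k :+ :⟦ 3 ⟧))) :* (i :* j))))
         refl N K z i′ j ⟩
    - ((1# + K + (1# + K) + ⟦ 2 ⟧) * (N + N + 1#) * (N + N + ⟦ 3 ⟧) * ζ n (suc k)) ∎
    where
    N  = ⟦ n ⟧
    K  = ⟦ k ⟧
    z  = ζ n k
    i  = evenInv k
    i′ = evenInv (suc k)
    j  = oddInv (suc (suc k) ℕ.+ n)
    factor = (1# + (1# + N) + K + K) * (1# + (1# + N) + K + K + 1#)

  -- Once ζ n k and n+1 are factored out, what remains is n(2n+2k+3) = (n+2k+2)(2n+1) - (n+1)(2k+2).
  γ-contiguous : ∀ n k → γ n (suc k) ≈ γ (suc n) (suc k) + κ n * γ (suc (suc n)) k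
  γ-contiguous n k = begin
    γ n (suc k)
      ≈⟨ γ≈ζ n k ⟩
    N * (N + 1#) * (N + N + K + K + ⟦ 3 ⟧) * z
      ≈⟨ solve 3 (λ n k z →
           n :* (n :+ :1) :* (n :+ n :+ k :+ k :+ :⟦ 3 ⟧) :* z
           := (n :+ :1) :* (n :+ k :+ k :+ :⟦ 2 ⟧) :* (n :+ n :+ :1) :* z
             :- (:1 :+ n) :* (:1 :+ n) :* (k :+ k :+ :⟦ 2 ⟧) :* z)
         refl N K z ⟩
    P - (1# + N) * (1# + N) * (K + K + ⟦ 2 ⟧) * z
      ≈⟨ +-congˡ (-‿cong (trans (sym (cancel _ (oddInv-inverse n))) (sym (cancel _ (oddInv-inverse (suc n)))))) ⟩
    P - (1# + N) * (1# + N) * (K + K + ⟦ 2 ⟧) * z * ((N + N + 1#) * i) * ((1# + N + (1# + N) + 1#) * j)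
      ≈⟨ solve 6 (λ n k z i j p →
           p :- (:1 :+ n) :* (:1 :+ n) :* (k :+ k :+ :⟦ 2 ⟧) :* z :* ((n :+ n :+ :1) :* i) :* ((:1 :+ n :+ (:1 :+ n) :+ :1) :* j)
           := p :+ (:1 :+ n) :* (:1 :+ n) :* (i :* j)
             :* (:- ((k :+ k :+ :⟦ 2 ⟧) :* (n :+ n :+ :1) :* (n :+ n :+ :⟦ 3 ⟧) :* z)))
         refl N K z i j P ⟩
    P + κ n * - ((K + K + ⟦ 2 ⟧) * (N + N + 1#) * (N + N + ⟦ 3 ⟧) * z)
      ≈⟨ +-cong (γ-suc≈ζ n k) (*-congˡ (γ-suc-suc≈ζ n k)) ⟨
    γ (suc n) (suc k) + κ n * γ (suc (suc n)) k ∎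
    where
    N = ⟦ n ⟧
    K = ⟦ k ⟧
    z = ζ n k
    i = oddInv n
    j = oddInv (suc n)
    P = (N + 1#) * (N + K + K + ⟦ 2 ⟧) * (N + N + 1#) * z

-- Triangular form in terms of the arctangent remainders.

module Reduction {c ℓ : Level} (A : CommutativeℚAlgebra c ℓ) (t : CommutativeℚAlgebra.Carrier A) where
  open CommutativeℚAlgebra A hiding (zero)
  open Series A
  open Solver A
  open Scalars A
  open RangeSums A
  open ColumnSpan A
  open Determinant A using (sign)
  open Derivatives A t
  open MonoidSum *-commutativeMonoid using () renaming (sum to product; sum-cong-≋ to product-cong)
  open SetoidReasoning setoid

  γ₁≈sign : ∀ l → (⟦ l ⟧ + ⟦ l ⟧ + 1#) * γ 1 l ≈ sign l
  γ₁≈sign zero    = solve 0 ((:0 :+ :0 :+ :1) :* :1 := :1) refl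
  γ₁≈sign (suc l) = begin
    (1# + L + (1# + L) + 1#) * γ 1 (suc l)
      ≈⟨ solve 4 (λ l g i j →
           (:1 :+ l :+ (:1 :+ l) :+ :1) :* (:- (g :* ((:1 :+ :0 :+ l :+ l) :* (:1 :+ :0 :+ l :+ l :+ :1))) :* (i :* j))
           := :- :1 :* ((l :+ l :+ :1) :* g) :* ((l :+ l :+ :1 :+ :1) :* i) :* ((l :+ (:1 :+ :0) :+ (l :+ (:1 :+ :0)) :+ :1) :* j))
         refl L (γ 1 l) (evenInv l) (oddInv (l ℕ.+ 1)) ⟩
    - 1# * ((L + L + 1#) * γ 1 l) * ((L + L + 1# + 1#) * evenInv l) * ((L + ⟦ 1 ⟧ + (L + ⟦ 1 ⟧) + 1#) * oddInv (l ℕ.+ 1))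
      ≈⟨ trans (cancel _ (oddInv-+-inverse l 1)) (cancel _ (evenInv-inverse l)) ⟩
    - 1# * ((L + L + 1#) * γ 1 l)
      ≈⟨ *-congˡ (γ₁≈sign l) ⟩
    - 1# * sign l ∎
    where L = ⟦ l ⟧

  -- Applied to the derivative of a partial sum of arctan (tan x), whose terms are (-1)ˡ tan²ˡ (1 +
  -- tan²).
  Σ<-telescope : ∀ (g : ℕ → Carrier) N → Σ< N (λ l → sign l * (g (suc l) + g l)) ≈ g 0 - sign N * g N
  Σ<-telescope g zero    = solve 1 (λ x → :0 := x :- :1 :* x) refl (g 0)
  Σ<-telescope g (suc N) = begin
    Σ< (suc N) (λ l → sign l * (g (suc l) + g l))
      ≈⟨ Σ<-last N (λ l → sign l * (g (suc l) + g l)) ⟩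
    Σ< N (λ l → sign l * (g (suc l) + g l)) + sign N * (g (suc N) + g N)
      ≈⟨ +-congʳ (Σ<-telescope g N) ⟩
    g 0 - sign N * g N + sign N * (g (suc N) + g N)
      ≈⟨ solve 4 (λ g₀ s g g′ → g₀ :- s :* g :+ s :* (g′ :+ g) := g₀ :- :- :1 :* s :* g′) refl (g 0) (sign N) (g N) (g (suc N)) ⟩
    g 0 - sign (suc N) * g (suc N) ∎

  -- x = arctan (tan x) = Σ (-1)ˡ tan²ˡ⁺¹ x / (2l+1), and γ 1 l is (-1)ˡ / (2l+1).
  y-arctan : ∀ k m N → k ≤ N → y k m ≈ Σ< N (λ l → γ 1 l * e k (dbl l ℕ.+ suc m))
  y-arctan zero    m N _   = sym (Σ<-zero N λ l →
    trans (*-congˡ (e-vanishes (ℕ.≤-trans (s≤s z≤n) (ℕ.m≤n+m (suc m) (dbl l))))) (zeroʳ (γ 1 l)))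
  y-arctan (suc k) m N k<N = begin
    y (suc k) m
      ≈⟨ y-step k m ⟩
    (t + ⟦ m ⟧) * y k (suc m) + ⟦ m ⟧ * y k (pred m) + e k m
      -- The extra summand `e k m` is `g 0`. The tail `sign N * g N` vanishes because k < 2N + m, so
      -- it may be subtracted to complete the telescoping sum.
      ≈⟨ +-cong (+-cong (*-congˡ (y-arctan k (suc m) N k≤N)) (predecessor m))
                (trans (sym (solve 2 (λ x s → x :- s :* :0 := x) refl (e k m) (sign N)))
                  (+-congˡ (-‿cong (*-congˡ (sym (e-vanishes k<dbl)))))) ⟩
    (t + ⟦ m ⟧) * Σ< N a + ⟦ m ⟧ * Σ< N b + (g 0 - sign N * g N)
      ≈⟨ +-cong (+-cong (sym (Σ<-* N (t + ⟦ m ⟧) a)) (sym (Σ<-* N ⟦ m ⟧ b))) (sym (Σ<-telescope g N)) ⟩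
    Σ< N (λ l → (t + ⟦ m ⟧) * a l) + Σ< N (λ l → ⟦ m ⟧ * b l) + Σ< N (λ l → sign l * (g (suc l) + g l))
      ≈⟨ +-congʳ (Σ<-+ N (λ l → (t + ⟦ m ⟧) * a l) (λ l → ⟦ m ⟧ * b l)) ⟨
    Σ< N (λ l → (t + ⟦ m ⟧) * a l + ⟦ m ⟧ * b l) + Σ< N (λ l → sign l * (g (suc l) + g l))
      ≈⟨ Σ<-+ N (λ l → (t + ⟦ m ⟧) * a l + ⟦ m ⟧ * b l) (λ l → sign l * (g (suc l) + g l)) ⟨
    Σ< N (λ l → (t + ⟦ m ⟧) * a l + ⟦ m ⟧ * b l + sign l * (g (suc l) + g l))
      ≈⟨ Σ<-cong N term ⟩
    Σ< N (λ l → γ 1 l * e (suc k) (dbl l ℕ.+ suc m)) ∎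
    where
    k≤N = ℕ.<⇒≤ k<N
    k<dbl : k < dbl N ℕ.+ m
    k<dbl = ℕ.<-≤-trans k<N (ℕ.≤-trans (n≤dbl[n] N) (ℕ.m≤m+n (dbl N) m))
    a b g : ℕ → Carrier
    a l = γ 1 l * e k (dbl l ℕ.+ suc (suc m))
    b l = γ 1 l * e k (dbl l ℕ.+ m)
    g l = e k (dbl l ℕ.+ m)
    predecessor : ∀ m → ⟦ m ⟧ * y k (pred m) ≈ ⟦ m ⟧ * Σ< N (λ l → γ 1 l * e k (dbl l ℕ.+ m))
    predecessor zero    = trans (zeroˡ _) (sym (zeroˡ _))
    predecessor (suc m) = *-congˡ (y-arctan k m N k≤N)
    term : ∀ l → (t + ⟦ m ⟧) * a l + ⟦ m ⟧ * b l + sign l * (g (suc l) + g l) ≈ γ 1 l * e (suc k) (dbl l ℕ.+ suc m)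
    term l = begin
      (t + ⟦ m ⟧) * a l + ⟦ m ⟧ * b l + sign l * (g (suc l) + g l)
        ≈⟨ +-cong (+-congʳ (*-congˡ (*-congˡ (reflexive (≡.cong (e k)
             (≡.trans (ℕ.+-suc (dbl l) (suc m)) (≡.cong suc (ℕ.+-suc (dbl l) m))))))))
             (*-congʳ (sym (γ₁≈sign l))) ⟩
      (t + ⟦ m ⟧) * (γ 1 l * g (suc l)) + ⟦ m ⟧ * (γ 1 l * g l) + (L + L + 1#) * γ 1 l * (g (suc l) + g l)
        ≈⟨ solve 6 (λ t m l c g′ g →
             (t :+ m) :* (c :* g′) :+ m :* (c :* g) :+ (l :+ l :+ :1) :* c :* (g′ :+ g)
             := c :* ((t :+ (:1 :+ (l :+ l :+ m))) :* g′ :+ (:1 :+ (l :+ l :+ m)) :* g))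
           refl t ⟦ m ⟧ L (γ 1 l) (g (suc l)) (g l) ⟩
      γ 1 l * ((t + (1# + (L + L + ⟦ m ⟧))) * g (suc l) + (1# + (L + L + ⟦ m ⟧)) * g l)
        ≈⟨ *-congˡ (+-cong (*-congʳ (+-congˡ (+-congˡ index))) (*-congʳ (+-congˡ index))) ⟨
      γ 1 l * e (suc k) (suc (dbl l ℕ.+ m))
        ≡⟨ ≡.cong (λ n → γ 1 l * e (suc k) n) (ℕ.+-suc (dbl l) m) ⟨
      γ 1 l * e (suc k) (dbl l ℕ.+ suc m) ∎
      where
      L = ⟦ l ⟧
      index : ⟦ dbl l ℕ.+ m ⟧ ≈ L + L + ⟦ m ⟧
      index = trans (⟦⟧-+ (dbl l) m) (+-congʳ (⟦⟧-dbl l))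

  -- R p w k is the k-th derivative at 0 of secᵗ Σᵣ wᵣ tan²⁽ᵖ⁺ʳ⁾.
  R : ℕ → (ℕ → Carrier) → ℕ → Carrier
  R p w k = Σ< (suc k) (λ r → e k (dbl (r ℕ.+ p)) * w r)

  e-vanishes-dbl : ∀ {k n} r → k < dbl n → e k (dbl (r ℕ.+ n)) ≈ 0#
  e-vanishes-dbl {n = n} r k<n = e-vanishes (ℕ.<-≤-trans k<n (dbl-mono-≤ (ℕ.m≤n+m n r)))

  R-contiguous : ∀ p {w u v} x → w 0 ≈ u 0 → (∀ r → w (suc r) ≈ u (suc r) + x * v r) →
    ∀ k → R p w k ≈ R p u k + x * R (suc p) v k
  R-contiguous p {w} {u} {v} x w≈u w≈u+xv k = begin
    e k (dbl p) * w 0 + Σ< k (λ r → ε r * w (suc r))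
      ≈⟨ +-cong (*-congˡ w≈u) (Σ<-cong k λ r → trans (*-congˡ (w≈u+xv r))
           (solve 4 (λ e u x v → e :* (u :+ x :* v) := e :* u :+ x :* (e :* v)) refl (ε r) (u (suc r)) x (v r))) ⟩
    e k (dbl p) * u 0 + Σ< k (λ r → ε r * u (suc r) + x * (ε r * v r))
      ≈⟨ +-congˡ (trans (Σ<-+ k (λ r → ε r * u (suc r)) (λ r → x * (ε r * v r))) (+-congˡ (Σ<-* k x (λ r → ε r * v r)))) ⟩
    e k (dbl p) * u 0 + (Σ< k (λ r → ε r * u (suc r)) + x * Σ< k (λ r → ε r * v r))
      ≈⟨ +-assoc _ _ _ ⟨
    R p u k + x * Σ< k (λ r → ε r * v r)
      ≈⟨ +-congˡ (*-congˡ (trans (+-identityʳ _) (Σ<-cong k λ r → *-congʳ {x = v r} (reflexive (≡.cong (e k ∘ dbl) (ℕ.+-suc r p)))))) ⟨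
    R p u k + x * (Σ< k (λ r → e k (dbl (r ℕ.+ suc p)) * v r) + 0#)
      -- The shifted sum is one term short of `R (suc p) v k`; that term has order above k in tan
      -- and is added as zero.
      ≈⟨ +-congˡ (*-congˡ (+-congˡ (trans (*-congʳ (e-vanishes k<dbl)) (zeroˡ (v k))))) ⟨
    R p u k + x * (Σ< k (λ r → e k (dbl (r ℕ.+ suc p)) * v r) + e k (dbl (k ℕ.+ suc p)) * v k)
      ≈⟨ +-congˡ (*-congˡ (Σ<-last k (λ r → e k (dbl (r ℕ.+ suc p)) * v r))) ⟨
    R p u k + x * R (suc p) v k ∎
    where
    ε : ℕ → Carrier
    ε r = e k (dbl (suc r ℕ.+ p))
    k<dbl : k < dbl (k ℕ.+ suc p)
    k<dbl = ℕ.<-≤-trans (ℕ.m<m+n k (s≤s z≤n)) (n≤dbl[n] (k ℕ.+ suc p))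

  K : ℕ → Sequence
  K n i = R n (γ n) (dbl i)

  K-lower : ∀ n i → i < n → K n i ≈ 0#
  K-lower n i i<n = Σ<-zero (suc (dbl i)) λ r →
    trans (*-congʳ (e-vanishes-dbl r (ℕ.≤-trans (s≤s (ℕ.n≤1+n (dbl i))) (dbl-mono-≤ i<n)))) (zeroˡ (γ n r))

  K-diagonal : ∀ n → K n n ≈ ⟦ dbl n ! ⟧
  K-diagonal n = trans
    (+-cong (trans (*-identityʳ _) (e-diagonal (dbl n)))
      (Σ<-zero (dbl n) λ r → trans (*-congʳ (e-vanishes (s≤s (ℕ.m≤n⇒m≤1+n (dbl-mono-≤ (ℕ.m≤n+m n r)))))) (zeroˡ (γ n (suc r)))))
    (+-identityʳ _)

  -- W q n belongs to tan²q times the function of K n.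
  W : ℕ → ℕ → Sequence
  W q n i = R (q ℕ.+ n) (γ n) (dbl i)

  W-contiguous : ∀ q n i → W (suc q) n i ≈ W q (suc n) i + κ n * W q (suc (suc n)) i
  W-contiguous q n i = trans
    (R-contiguous (suc (q ℕ.+ n)) {γ n} {γ (suc n)} (κ n) refl (γ-contiguous n) (dbl i))
    (reflexive (≡.cong₂ (λ p p′ → R p (γ (suc n)) (dbl i) + κ n * R p′ (γ (suc (suc n))) (dbl i))
      (≡.sym (ℕ.+-suc q n)) (≡.sym (≡.trans (ℕ.+-suc q (suc n)) (≡.cong suc (ℕ.+-suc q n))))))

  W∈K : ∀ q n → Span K (suc (dbl q ℕ.+ n)) (W q n)
  W∈K zero    n = generator (ℕ.n<1+n n)
  W∈K (suc q) n = respects (λ i → trans (+-comm _ _) (sym (W-contiguous q n i)))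
    (combine (κ n)
      (≡.subst (λ j → Span K (suc j) (W q (suc (suc n)))) (+-suc-suc (dbl q) n) (W∈K q (suc (suc n))))
      (Span-weaken (s≤s (ℕ.m≤n⇒m≤1+n (ℕ.≤-reflexive (ℕ.+-suc (dbl q) n)))) (W∈K q (suc n))))

  -- η l is the coefficient with which K l occurs in B l.
  η : ℕ → Carrier
  η zero          = 1#
  η (suc zero)    = 1#
  η (suc (suc n)) = κ n * η n

  -- Each factor tan² moves the leading index from n to n+2 at the cost of `κ n`. The weight `η n`
  -- absorbs these costs into `η` at the final index, without quotients of values of `η`.
  W-leads : ∀ q n → Leads K (dbl q ℕ.+ n) (η (dbl q ℕ.+ n)) (λ i → η n * W q n i)
  W-leads zero    n = leads null (λ i → sym (+-identityʳ _))
  W-leads (suc q) n = Leads-respects refl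
    (λ i → trans (solve 4 (λ k h w w′ → k :* h :* w′ :+ h :* w := h :* (w :+ k :* w′)) refl
        (κ n) (η n) (W q (suc n) i) (W q (suc (suc n)) i))
      (*-congˡ (sym (W-contiguous q n i))))
    (Leads-+
      (≡.subst (λ j → Leads K j (η j) (λ i → η (suc (suc n)) * W q (suc (suc n)) i))
        (+-suc-suc (dbl q) n) (W-leads q (suc (suc n))))
      (Span-* (η n) (≡.subst (λ j → Span K j (W q (suc n))) (≡.cong suc (ℕ.+-suc (dbl q) n)) (W∈K q (suc n)))))

  -- The upper parameter n/2 is 0, so the hypergeometric series is 1 and `K 0` belongs to F itself.
  γ₀≈0 : ∀ k → γ 0 (suc k) ≈ 0#
  γ₀≈0 zero    = solve 1 (λ x → :- (:1 :* ((:0 :+ :0 :+ :0) :* (:0 :+ :0 :+ :0 :+ :1))) :* x := :0) refl _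
  γ₀≈0 (suc k) = trans (*-congʳ (-‿cong (*-congʳ (γ₀≈0 k))))
    (solve 2 (λ x y → :- (:0 :* x) :* y := :0) refl _ _)

  B-even : ∀ q i → B (dbl q) i ≈ W q 0 i
  B-even q i = begin
    e k (dbl q) + y k (dbl q)
      ≈⟨ +-congˡ (y-even-even i q) ⟩
    e k (dbl q) + 0#
      ≈⟨ +-cong (trans (reflexive (≡.cong (e k ∘ dbl) (≡.sym (ℕ.+-identityʳ q)))) (sym (*-identityʳ _)))
           (sym (Σ<-zero k λ r → trans (*-congˡ (γ₀≈0 r)) (zeroʳ (e k (dbl (suc r ℕ.+ (q ℕ.+ 0))))))) ⟩
    W q 0 i ∎
    where k = dbl i

  B-odd : ∀ q i → B (suc (dbl q)) i ≈ W q 1 i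
  B-odd q i = begin
    e k (suc (dbl q)) + y k (suc (dbl q))
      ≈⟨ +-cong (e-even-odd i q) (y-arctan k (suc (dbl q)) (suc k) (ℕ.n≤1+n k)) ⟩
    0# + Σ< (suc k) (λ l → γ 1 l * e k (dbl l ℕ.+ dbl (suc q)))
      ≈⟨ trans (+-identityˡ _) (Σ<-cong (suc k) λ l → trans (*-comm (γ 1 l) (e k (dbl l ℕ.+ dbl (suc q))))
           (*-congʳ {x = γ 1 l} (reflexive (≡.cong (e k) (≡.trans (≡.sym (dbl-+ l (suc q)))
             (≡.cong (λ p → dbl (l ℕ.+ p)) (ℕ.+-comm 1 q))))))) ⟩
    W q 1 i ∎
    where k = dbl i

  B-leads : ∀ l → Leads K l (η l) (B l)
  B-leads l with parity l
  ... | inj₁ (q , ≡.refl) = Leads-respects refl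
    (λ i → trans (*-identityˡ _) (sym (B-even q i)))
    (≡.subst (λ j → Leads K j (η j) (λ i → 1# * W q 0 i)) (ℕ.+-identityʳ (dbl q)) (W-leads q 0))
  ... | inj₂ (q , ≡.refl) = Leads-respects refl
    (λ i → trans (*-identityˡ _) (sym (B-odd q i)))
    (≡.subst (λ j → Leads K j (η j) (λ i → 1# * W q 1 i)) (ℕ.+-comm (dbl q) 1) (W-leads q 1))

  -- The denominators of `κ n` cancel the odd factors 2n+1 and 2n+3 of (2n+4)! / (2n)!.
  pivot≈ : ∀ n → ⟦ dbl n ! ⟧ * η n ≈ ⟦ pivot n ⟧
  pivot≈ zero          = *-identityʳ _
  pivot≈ (suc zero)    = *-identityʳ _
  pivot≈ (suc (suc n)) = begin
    ⟦ dbl (suc (suc n)) ! ⟧ * (κ n * η n)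
      ≈⟨ *-congʳ (trans (⟦⟧-* (4 ℕ.+ d) ((3 ℕ.+ d) !)) (*-congˡ (trans (⟦⟧-* (3 ℕ.+ d) ((2 ℕ.+ d) !)) (*-congˡ
           (trans (⟦⟧-* (2 ℕ.+ d) ((1 ℕ.+ d) !)) (*-congˡ (⟦⟧-* (1 ℕ.+ d) (d !)))))))) ⟩
    ⟦ 4 ℕ.+ d ⟧ * (⟦ 3 ℕ.+ d ⟧ * (⟦ 2 ℕ.+ d ⟧ * (⟦ 1 ℕ.+ d ⟧ * ⟦ d ! ⟧))) * (κ n * η n)
      ≈⟨ *-congʳ (*-cong (add 4) (*-cong (add 3) (*-cong (add 2) (*-congʳ (add 1))))) ⟩
    (⟦ 4 ⟧ + (J + J)) * ((⟦ 3 ⟧ + (J + J)) * ((⟦ 2 ⟧ + (J + J)) * ((⟦ 1 ⟧ + (J + J)) * ⟦ d ! ⟧))) * (κ n * η n)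
      ≈⟨ solve 5 (λ n f i j h →
           (:⟦ 4 ⟧ :+ (n :+ n)) :* ((:⟦ 3 ⟧ :+ (n :+ n)) :* ((:⟦ 2 ⟧ :+ (n :+ n)) :* ((:⟦ 1 ⟧ :+ (n :+ n)) :* f)))
             :* ((:1 :+ n) :* (:1 :+ n) :* (i :* j) :* h)
           := :⟦ 4 ⟧ :* ((:1 :+ n) :* (:1 :+ n) :* ((:1 :+ n) :* (:1 :+ (:1 :+ n)))) :* (f :* h)
             :* ((n :+ n :+ :1) :* i) :* ((:1 :+ n :+ (:1 :+ n) :+ :1) :* j))
         refl J ⟦ d ! ⟧ (oddInv n) (oddInv (suc n)) (η n) ⟩
    ⟦ 4 ⟧ * (S * S * (S * ⟦ suc (suc n) ⟧)) * (⟦ d ! ⟧ * η n) * ((J + J + 1#) * oddInv n) * ((S + S + 1#) * oddInv (suc n))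
      ≈⟨ trans (cancel _ (oddInv-inverse (suc n))) (cancel _ (oddInv-inverse n)) ⟩
    ⟦ 4 ⟧ * (S * S * (S * ⟦ suc (suc n) ⟧)) * (⟦ d ! ⟧ * η n)
      ≈⟨ *-cong (*-congˡ (*-cong (sym (⟦⟧-* (suc n) (suc n))) (sym (⟦⟧-* (suc n) (suc (suc n)))))) (pivot≈ n) ⟩
    ⟦ 4 ⟧ * (⟦ suc n ℕ.* suc n ⟧ * ⟦ suc n ℕ.* suc (suc n) ⟧) * ⟦ pivot n ⟧
      ≈⟨ *-congʳ (*-congˡ (sym (⟦⟧-* (suc n ℕ.* suc n) (suc n ℕ.* suc (suc n))))) ⟩
    ⟦ 4 ⟧ * ⟦ suc n ℕ.* suc n ℕ.* (suc n ℕ.* suc (suc n)) ⟧ * ⟦ pivot n ⟧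
      ≈⟨ *-congʳ (⟦⟧-* 4 (suc n ℕ.* suc n ℕ.* (suc n ℕ.* suc (suc n)))) ⟨
    ⟦ 4 ℕ.* (suc n ℕ.* suc n ℕ.* (suc n ℕ.* suc (suc n))) ⟧ * ⟦ pivot n ⟧
      ≈⟨ ⟦⟧-* (4 ℕ.* (suc n ℕ.* suc n ℕ.* (suc n ℕ.* suc (suc n)))) (pivot n) ⟨
    ⟦ 4 ℕ.* (suc n ℕ.* suc n ℕ.* (suc n ℕ.* suc (suc n))) ℕ.* pivot n ⟧
      ≡⟨ ≡.cong ⟦_⟧ (pivot-step n) ⟨
    ⟦ pivot (suc (suc n)) ⟧ ∎
    where
    d = dbl n
    J = ⟦ n ⟧
    S = ⟦ suc n ⟧
    add : ∀ m → ⟦ m ℕ.+ d ⟧ ≈ ⟦ m ⟧ + (J + J)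
    add m = trans (⟦⟧-+ m d) (+-congˡ (⟦⟧-dbl n))

  det-M : ∀ N → det N (λ i j → M (toℕ j) (toℕ i)) ≈
    product {N} (λ i → ⟦ pivot (toℕ i) ⟧ * pochhammer t (toℕ i))
  det-M N = trans
    (det-leads M (λ j → pochhammer t j * η j) K-lower (λ j → Leads-trans B-leads (M-leads j)) N)
    (product-cong {N} λ i → let n = toℕ i in begin
      K n n * (pochhammer t n * η n)
        ≈⟨ *-congʳ (K-diagonal n) ⟩
      ⟦ dbl n ! ⟧ * (pochhammer t n * η n)
        ≈⟨ solve 3 (λ k p h → k :* (p :* h) := k :* h :* p) refl ⟦ dbl n ! ⟧ (pochhammer t n) (η n) ⟩
      ⟦ dbl n ! ⟧ * η n * pochhammer t n
        ≈⟨ *-congʳ (pivot≈ n) ⟩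
      ⟦ pivot n ⟧ * pochhammer t n ∎)

-- Formal power series and their derivative.

module PowerSeries {c ℓ : Level} (A : CommutativeℚAlgebra c ℓ) where
  open CommutativeℚAlgebra A hiding (zero)
  open Series A
  open Solver A
  open Scalars A
  open SetoidReasoning setoid

  infix 4 _≈ₛ_
  _≈ₛ_ : PowerSeries → PowerSeries → Set ℓ
  u ≈ₛ v = ∀ k → u k ≈ v k

  infixl 7 _∙_
  _∙_ : Carrier → PowerSeries → PowerSeries
  (x ∙ u) k = x * u k

  shift : PowerSeries → PowerSeries
  shift u k = u (suc k)

  *ₛ-cong : ∀ {u u′ v v′} → u ≈ₛ u′ → v ≈ₛ v′ → u *ₛ v ≈ₛ u′ *ₛ v′
  *ₛ-cong u≈ v≈ zero    = +-congʳ (*-cong (u≈ 0) (v≈ 0))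
  *ₛ-cong {u} {u′} {v} {v′} u≈ v≈ (suc k) =
    +-cong (*-cong (u≈ 0) (v≈ (suc k))) (*ₛ-cong {shift u} {shift u′} {v} {v′} (λ i → u≈ (suc i)) v≈ k)

  *ₛ-congˡ : ∀ u {v v′} → v ≈ₛ v′ → u *ₛ v ≈ₛ u *ₛ v′
  *ₛ-congˡ u {v} {v′} v≈ = *ₛ-cong {u} {u} {v} {v′} (λ _ → refl) v≈

  *ₛ-congʳ : ∀ v {u u′} → u ≈ₛ u′ → u *ₛ v ≈ₛ u′ *ₛ v
  *ₛ-congʳ v {u} {u′} u≈ = *ₛ-cong {u} {u′} {v} {v} u≈ (λ _ → refl)

  -- The Cauchy product unfolds along its left factor; this mirror image is what commutativity rests
  -- on.
  *ₛ-shiftʳ : ∀ u v k → (u *ₛ v) (suc k) ≈ u (suc k) * v 0 + (u *ₛ shift v) k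
  *ₛ-shiftʳ u v zero    = solve 2 (λ a b → a :+ (b :+ :0) := b :+ (a :+ :0)) refl (u 0 * v 1) (u 1 * v 0)
  *ₛ-shiftʳ u v (suc k) = trans (+-congˡ (*ₛ-shiftʳ (shift u) v k))
    (solve 3 (λ a b c → a :+ (b :+ c) := b :+ (a :+ c)) refl
      (u 0 * v (suc (suc k))) (u (suc (suc k)) * v 0) ((shift u *ₛ shift v) k))

  *ₛ-comm : ∀ u v → u *ₛ v ≈ₛ v *ₛ u
  *ₛ-comm u v zero    = +-congʳ (*-comm (u 0) (v 0))
  *ₛ-comm u v (suc k) = trans (+-cong (*-comm (u 0) (v (suc k))) (*ₛ-comm (shift u) v k)) (sym (*ₛ-shiftʳ v u k))

  -- Scaling and addition are combined because the shift of u v is u₀ times the shift of v plus the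
  -- shift of u times v, the shape met in associativity.
  *ₛ-linearˡ : ∀ x u v w → (x ∙ u +ₛ v) *ₛ w ≈ₛ x ∙ (u *ₛ w) +ₛ v *ₛ w
  *ₛ-linearˡ x u v w zero    = solve 4 (λ x u v w → (x :* u :+ v) :* w :+ :0 := x :* (u :* w :+ :0) :+ (v :* w :+ :0))
    refl x (u 0) (v 0) (w 0)
  *ₛ-linearˡ x u v w (suc k) = trans (+-congˡ (*ₛ-linearˡ x (shift u) (shift v) w k))
    (solve 6 (λ x u v w p q → (x :* u :+ v) :* w :+ (x :* p :+ q) := x :* (u :* w :+ p) :+ (v :* w :+ q))
      refl x (u 0) (v 0) (w (suc k)) ((shift u *ₛ w) k) ((shift v *ₛ w) k))

  *ₛ-zeroˡ : ∀ {u} v → (∀ k → u k ≈ 0#) → ∀ k → (u *ₛ v) k ≈ 0#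
  *ₛ-zeroˡ v u≈0 zero    = trans (+-congʳ (*-congʳ (u≈0 0))) (solve 1 (λ x → :0 :* x :+ :0 := :0) refl (v 0))
  *ₛ-zeroˡ {u} v u≈0 (suc k) = trans (+-cong (*-congʳ (u≈0 0)) (*ₛ-zeroˡ {shift u} v (λ i → u≈0 (suc i)) k))
    (solve 1 (λ x → :0 :* x :+ :0 := :0) refl (v (suc k)))

  *ₛ-scaleˡ : ∀ x u w → (x ∙ u) *ₛ w ≈ₛ x ∙ (u *ₛ w)
  *ₛ-scaleˡ x u w k = begin
    ((x ∙ u) *ₛ w) k                             ≈⟨ *ₛ-congʳ w {x ∙ u} {x ∙ u +ₛ λ _ → 0#} (λ i → sym (+-identityʳ (x * u i))) k ⟩
    ((x ∙ u +ₛ λ _ → 0#) *ₛ w) k                 ≈⟨ *ₛ-linearˡ x u (λ _ → 0#) w k ⟩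
    x * (u *ₛ w) k + ((λ _ → 0#) *ₛ w) k         ≈⟨ +-congˡ (*ₛ-zeroˡ {λ _ → 0#} w (λ _ → refl) k) ⟩
    x * (u *ₛ w) k + 0#                          ≈⟨ +-identityʳ _ ⟩
    x * (u *ₛ w) k                               ∎

  *ₛ-scaleʳ : ∀ x u w → u *ₛ (x ∙ w) ≈ₛ x ∙ (u *ₛ w)
  *ₛ-scaleʳ x u w k = begin
    (u *ₛ (x ∙ w)) k   ≈⟨ *ₛ-comm u (x ∙ w) k ⟩
    ((x ∙ w) *ₛ u) k   ≈⟨ *ₛ-scaleˡ x w u k ⟩
    x * (w *ₛ u) k     ≈⟨ *-congˡ (*ₛ-comm w u k) ⟩
    x * (u *ₛ w) k     ∎

  *ₛ-distribʳ : ∀ u v w → (u +ₛ v) *ₛ w ≈ₛ u *ₛ w +ₛ v *ₛ w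
  *ₛ-distribʳ u v w k = begin
    ((u +ₛ v) *ₛ w) k                ≈⟨ *ₛ-congʳ w {u +ₛ v} {1# ∙ u +ₛ v} (λ i → +-congʳ (sym (*-identityˡ (u i)))) k ⟩
    ((1# ∙ u +ₛ v) *ₛ w) k           ≈⟨ *ₛ-linearˡ 1# u v w k ⟩
    1# * (u *ₛ w) k + (v *ₛ w) k     ≈⟨ +-congʳ (*-identityˡ _) ⟩
    (u *ₛ w) k + (v *ₛ w) k          ∎

  *ₛ-assoc : ∀ u v w → (u *ₛ v) *ₛ w ≈ₛ u *ₛ (v *ₛ w)
  *ₛ-assoc u v w zero    = solve 3 (λ u v w → (u :* v :+ :0) :* w :+ :0 := u :* (v :* w :+ :0) :+ :0) refl (u 0) (v 0) (w 0)
  *ₛ-assoc u v w (suc k) = begin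
    (u 0 * v 0 + 0#) * w (suc k) + (shift (u *ₛ v) *ₛ w) k
      ≈⟨ +-congˡ (*ₛ-linearˡ (u 0) (shift v) (shift u *ₛ v) w k) ⟩
    (u 0 * v 0 + 0#) * w (suc k) + (u 0 * (shift v *ₛ w) k + ((shift u *ₛ v) *ₛ w) k)
      ≈⟨ +-congˡ (+-congˡ (*ₛ-assoc (shift u) v w k)) ⟩
    (u 0 * v 0 + 0#) * w (suc k) + (u 0 * (shift v *ₛ w) k + (shift u *ₛ (v *ₛ w)) k)
      ≈⟨ solve 5 (λ u v w p q → (u :* v :+ :0) :* w :+ (u :* p :+ q) := u :* (v :* w :+ p) :+ q) refl
           (u 0) (v 0) (w (suc k)) ((shift v *ₛ w) k) ((shift u *ₛ (v *ₛ w)) k) ⟩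
    (u *ₛ (v *ₛ w)) (suc k) ∎

  *ₛ-identityˡ : ∀ u → 1ₛ *ₛ u ≈ₛ u
  *ₛ-identityˡ u zero    = solve 1 (λ x → :1 :* x :+ :0 := x) refl (u 0)
  *ₛ-identityˡ u (suc k) = trans (+-cong (*-identityˡ _) (*ₛ-zeroˡ {λ _ → 0#} u (λ _ → refl) k)) (+-identityʳ _)

  *ₛ-identityʳ : ∀ u → u *ₛ 1ₛ ≈ₛ u
  *ₛ-identityʳ u k = trans (*ₛ-comm u 1ₛ k) (*ₛ-identityˡ u k)

  -- `Euler` is x d/dx. It preserves degrees, so its product rule follows the recursion of the
  -- product; `D` is its shift.
  Euler D : PowerSeries → PowerSeries
  Euler u k = ⟦ k ⟧ * u k
  D u k     = ⟦ suc k ⟧ * u (suc k)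

  Euler-* : ∀ u v k → Euler (u *ₛ v) k ≈ (Euler u *ₛ v) k + (u *ₛ Euler v) k
  Euler-* u v zero    = solve 2 (λ u v → :0 :* (u :* v :+ :0) := (:0 :* u :* v :+ :0) :+ (u :* (:0 :* v) :+ :0)) refl (u 0) (v 0)
  Euler-* u v (suc k) = begin
    (1# + ⟦ k ⟧) * (u 0 * v (suc k) + P)
      ≈⟨ solve 4 (λ n u v p → (:1 :+ n) :* (u :* v :+ p) := (:1 :+ n) :* (u :* v) :+ p :+ n :* p) refl ⟦ k ⟧ (u 0) (v (suc k)) P ⟩
    (1# + ⟦ k ⟧) * (u 0 * v (suc k)) + P + ⟦ k ⟧ * P
      ≈⟨ +-congˡ (Euler-* (shift u) v k) ⟩
    (1# + ⟦ k ⟧) * (u 0 * v (suc k)) + P + ((Euler (shift u) *ₛ v) k + (shift u *ₛ Euler v) k)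
      ≈⟨ solve 6 (λ n u v p q r → (:1 :+ n) :* (u :* v) :+ p :+ (q :+ r) := :0 :* u :* v :+ (p :+ q) :+ (u :* ((:1 :+ n) :* v) :+ r))
           refl ⟦ k ⟧ (u 0) (v (suc k)) P ((Euler (shift u) *ₛ v) k) ((shift u *ₛ Euler v) k) ⟩
    0# * u 0 * v (suc k) + (P + (Euler (shift u) *ₛ v) k) + (u *ₛ Euler v) (suc k)
      ≈⟨ +-congʳ (+-congˡ (*ₛ-distribʳ (shift u) (Euler (shift u)) v k)) ⟨
    0# * u 0 * v (suc k) + ((shift u +ₛ Euler (shift u)) *ₛ v) k + (u *ₛ Euler v) (suc k)
      ≈⟨ +-congʳ (+-congˡ (*ₛ-congʳ v {shift u +ₛ Euler (shift u)} {D u}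
           (λ i → solve 2 (λ n x → x :+ n :* x := (:1 :+ n) :* x) refl ⟦ i ⟧ (u (suc i))) k)) ⟩
    (Euler u *ₛ v) (suc k) + (u *ₛ Euler v) (suc k) ∎
    where P = (shift u *ₛ v) k

  D-* : ∀ u v → D (u *ₛ v) ≈ₛ D u *ₛ v +ₛ u *ₛ D v
  D-* u v k = begin
    Euler (u *ₛ v) (suc k)
      ≈⟨ Euler-* u v (suc k) ⟩
    0# * u 0 * v (suc k) + (D u *ₛ v) k + (u *ₛ Euler v) (suc k)
      ≈⟨ +-congˡ (*ₛ-shiftʳ u (Euler v) k) ⟩
    0# * u 0 * v (suc k) + (D u *ₛ v) k + (u (suc k) * (0# * v 0) + (u *ₛ D v) k)
      ≈⟨ solve 6 (λ a b c d p q → :0 :* a :* b :+ p :+ (c :* (:0 :* d) :+ q) := p :+ q) refl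
           (u 0) (v (suc k)) (u (suc k)) (v 0) ((D u *ₛ v) k) ((u *ₛ D v) k) ⟩
    (D u *ₛ v) k + (u *ₛ D v) k ∎

  D-^ : ∀ u p → D (u ^ₛ p) ≈ₛ ⟦ p ⟧ ∙ (u ^ₛ pred p *ₛ D u)
  D-^ u zero    k = trans (zeroʳ _) (sym (zeroˡ _))
  D-^ u (suc p) k = begin
    D (u *ₛ u ^ₛ p) k
      ≈⟨ D-* u (u ^ₛ p) k ⟩
    (D u *ₛ u ^ₛ p) k + (u *ₛ D (u ^ₛ p)) k
      ≈⟨ +-cong (*ₛ-comm (D u) (u ^ₛ p) k) (*ₛ-congˡ u (D-^ u p) k) ⟩
    (u ^ₛ p *ₛ D u) k + (u *ₛ (⟦ p ⟧ ∙ (u ^ₛ pred p *ₛ D u))) k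
      ≈⟨ +-congˡ (*ₛ-scaleʳ ⟦ p ⟧ u (u ^ₛ pred p *ₛ D u) k) ⟩
    (u ^ₛ p *ₛ D u) k + ⟦ p ⟧ * (u *ₛ (u ^ₛ pred p *ₛ D u)) k
      ≈⟨ +-cong (sym (*-identityˡ _)) (raise p) ⟩
    1# * (u ^ₛ p *ₛ D u) k + ⟦ p ⟧ * (u ^ₛ p *ₛ D u) k
      ≈⟨ distribʳ _ _ _ ⟨
    ⟦ suc p ⟧ * (u ^ₛ p *ₛ D u) k ∎
    where
    raise : ∀ p → ⟦ p ⟧ * (u *ₛ (u ^ₛ pred p *ₛ D u)) k ≈ ⟦ p ⟧ * (u ^ₛ p *ₛ D u) k
    raise zero    = trans (zeroˡ _) (sym (zeroˡ _))
    raise (suc p) = *-congˡ (sym (*ₛ-assoc u (u ^ₛ p) (D u) k))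

-- Derivatives of products of powers of cos - 1 and sin.

module Cosine {c ℓ : Level} (A : CommutativeℚAlgebra c ℓ) where
  open CommutativeℚAlgebra A hiding (zero)
  open Series A
  open Solver A
  open Scalars A
  open PowerSeries A
  open IsRingHomomorphism ι-isRingHomomorphism using (1#-homo)
  open SetoidReasoning setoid

  1/!-step : ∀ k → ⟦ suc k ⟧ * 1/ suc k ! ≈ 1/ k !
  1/!-step k = cancel-⟦⟧ (k !) {{ℕ._!≢0 k}} (begin
    ⟦ k ! ⟧ * (⟦ suc k ⟧ * 1/ suc k !)   ≈⟨ solve 3 (λ a b x → a :* (b :* x) := b :* a :* x) refl _ _ _ ⟩
    ⟦ suc k ⟧ * ⟦ k ! ⟧ * 1/ suc k !     ≈⟨ *-congʳ (⟦⟧-* (suc k) (k !)) ⟨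
    ⟦ suc k ! ⟧ * 1/ suc k !             ≈⟨ 1/!-inverse (suc k) ⟩
    1#                                   ≈⟨ 1/!-inverse k ⟨
    ⟦ k ! ⟧ * 1/ k !                     ∎)

  D-cos : ∀ k → D cos k ≈ cosDerivative (suc k) * 1/ k !
  D-cos k = trans (solve 3 (λ a b x → a :* (b :* x) := b :* (a :* x)) refl ⟦ suc k ⟧ (cosDerivative (suc k)) (1/ suc k !))
    (*-congˡ (1/!-step k))

  sin : PowerSeries
  sin = (- 1#) ∙ D cos

  D-sin : D sin ≈ₛ cos
  D-sin k = begin
    ⟦ suc k ⟧ * (- 1# * D cos (suc k))
      ≈⟨ *-congˡ (*-congˡ (D-cos (suc k))) ⟩
    ⟦ suc k ⟧ * (- 1# * (- cosDerivative k * 1/ suc k !))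
      ≈⟨ solve 3 (λ a b x → a :* (:- :1 :* (:- b :* x)) := b :* (a :* x)) refl ⟦ suc k ⟧ (cosDerivative k) (1/ suc k !) ⟩
    cosDerivative k * (⟦ suc k ⟧ * 1/ suc k !)
      ≈⟨ *-congˡ (1/!-step k) ⟩
    cos k ∎

  cos-1 : PowerSeries
  cos-1 = cos -ₛ 1ₛ

  D-cos-1 : D cos-1 ≈ₛ (- 1#) ∙ sin
  D-cos-1 k = solve 2 (λ n x → (:1 :+ n) :* (x :- :0) := :- :1 :* (:- :1 :* ((:1 :+ n) :* x))) refl ⟦ k ⟧ (cos (suc k))

  -- Powers of cos - 1 rather than of cos, because `^^` expands in powers of u - 1.
  S : ℕ → ℕ → PowerSeries
  S p m = cos-1 ^ₛ p *ₛ sin ^ₛ m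

  -- Rewriting the derivative of sin as 1 + (cos - 1) keeps the family closed under `D`.
  D-S : ∀ p m k → D (S p m) k ≈
    - (⟦ p ⟧ * S (pred p) (suc m) k) + ⟦ m ⟧ * (S p (pred m) k + S (suc p) (pred m) k)
  D-S p m k = begin
    D (v ^ₛ p *ₛ sin ^ₛ m) k
      ≈⟨ D-* (v ^ₛ p) (sin ^ₛ m) k ⟩
    (D (v ^ₛ p) *ₛ sin ^ₛ m) k + (v ^ₛ p *ₛ D (sin ^ₛ m)) k
      ≈⟨ +-cong (*ₛ-congʳ (sin ^ₛ m) (D-^ v p) k) (*ₛ-congˡ (v ^ₛ p) (D-^ sin m) k) ⟩
    ((⟦ p ⟧ ∙ (v ^ₛ pred p *ₛ D v)) *ₛ sin ^ₛ m) k + (v ^ₛ p *ₛ (⟦ m ⟧ ∙ (sin ^ₛ pred m *ₛ D sin))) k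
      ≈⟨ +-cong (*ₛ-scaleˡ ⟦ p ⟧ (v ^ₛ pred p *ₛ D v) (sin ^ₛ m) k) (*ₛ-scaleʳ ⟦ m ⟧ (v ^ₛ p) (sin ^ₛ pred m *ₛ D sin) k) ⟩
    ⟦ p ⟧ * ((v ^ₛ pred p *ₛ D v) *ₛ sin ^ₛ m) k + ⟦ m ⟧ * (v ^ₛ p *ₛ (sin ^ₛ pred m *ₛ D sin)) k
      ≈⟨ +-cong (*-congˡ first) (*-congˡ second) ⟩
    ⟦ p ⟧ * (- 1# * S (pred p) (suc m) k) + ⟦ m ⟧ * (S p (pred m) k + S (suc p) (pred m) k)
      ≈⟨ +-congʳ (solve 2 (λ p x → p :* (:- :1 :* x) := :- (p :* x)) refl ⟦ p ⟧ (S (pred p) (suc m) k)) ⟩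
    - (⟦ p ⟧ * S (pred p) (suc m) k) + ⟦ m ⟧ * (S p (pred m) k + S (suc p) (pred m) k) ∎
    where
    v = cos-1
    first : ((v ^ₛ pred p *ₛ D v) *ₛ sin ^ₛ m) k ≈ - 1# * S (pred p) (suc m) k
    first = begin
      ((v ^ₛ pred p *ₛ D v) *ₛ sin ^ₛ m) k
        ≈⟨ *ₛ-assoc (v ^ₛ pred p) (D v) (sin ^ₛ m) k ⟩
      (v ^ₛ pred p *ₛ (D v *ₛ sin ^ₛ m)) k
        ≈⟨ *ₛ-congˡ (v ^ₛ pred p) {D v *ₛ sin ^ₛ m} {(- 1#) ∙ sin ^ₛ suc m}
             (λ i → trans (*ₛ-congʳ (sin ^ₛ m) D-cos-1 i) (*ₛ-scaleˡ (- 1#) sin (sin ^ₛ m) i)) k ⟩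
      (v ^ₛ pred p *ₛ ((- 1#) ∙ sin ^ₛ suc m)) k
        ≈⟨ *ₛ-scaleʳ (- 1#) (v ^ₛ pred p) (sin ^ₛ suc m) k ⟩
      - 1# * S (pred p) (suc m) k ∎
    second : (v ^ₛ p *ₛ (sin ^ₛ pred m *ₛ D sin)) k ≈ S p (pred m) k + S (suc p) (pred m) k
    second = begin
      (v ^ₛ p *ₛ (sin ^ₛ pred m *ₛ D sin)) k
        ≈⟨ *ₛ-assoc (v ^ₛ p) (sin ^ₛ pred m) (D sin) k ⟨
      (S p (pred m) *ₛ D sin) k
        ≈⟨ *ₛ-comm (S p (pred m)) (D sin) k ⟩
      (D sin *ₛ S p (pred m)) k
        ≈⟨ *ₛ-congʳ (S p (pred m)) {D sin} {1ₛ +ₛ v}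
             (λ i → trans (D-sin i) (solve 2 (λ c d → c := d :+ (c :- d)) refl (cos i) (1ₛ i))) k ⟩
      ((1ₛ +ₛ v) *ₛ S p (pred m)) k
        ≈⟨ *ₛ-distribʳ 1ₛ v (S p (pred m)) k ⟩
      (1ₛ *ₛ S p (pred m)) k + (v *ₛ S p (pred m)) k
        ≈⟨ +-cong (*ₛ-identityˡ (S p (pred m)) k) (sym (*ₛ-assoc v (v ^ₛ p) (sin ^ₛ pred m) k)) ⟩
      S p (pred m) k + S (suc p) (pred m) k ∎

  ε : ℕ → ℕ → ℕ → Carrier
  ε k p m = egfCoeff (S p m) k

  ε-step : ∀ k p m → ε (suc k) p m ≈
    - (⟦ p ⟧ * ε k (pred p) (suc m)) + ⟦ m ⟧ * (ε k p (pred m) + ε k (suc p) (pred m))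
  ε-step k p m = begin
    ⟦ suc k ! ⟧ * S p m (suc k)
      ≈⟨ *-congʳ (⟦⟧-* (suc k) (k !)) ⟩
    ⟦ suc k ⟧ * ⟦ k ! ⟧ * S p m (suc k)
      ≈⟨ solve 3 (λ a b x → a :* b :* x := b :* (a :* x)) refl ⟦ suc k ⟧ ⟦ k ! ⟧ (S p m (suc k)) ⟩
    ⟦ k ! ⟧ * D (S p m) k
      ≈⟨ *-congˡ (D-S p m k) ⟩
    ⟦ k ! ⟧ * (- (⟦ p ⟧ * S (pred p) (suc m) k) + ⟦ m ⟧ * (S p (pred m) k + S (suc p) (pred m) k))
      ≈⟨ solve 6 (λ a p m x y z → a :* (:- (p :* x) :+ m :* (y :+ z)) := :- (p :* (a :* x)) :+ m :* (a :* y :+ a :* z)) refl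
           ⟦ k ! ⟧ ⟦ p ⟧ ⟦ m ⟧ (S (pred p) (suc m) k) (S p (pred m) k) (S (suc p) (pred m) k) ⟩
    - (⟦ p ⟧ * ε k (pred p) (suc m)) + ⟦ m ⟧ * (ε k p (pred m) + ε k (suc p) (pred m)) ∎

  cos-1-constant : cos-1 0 ≈ 0#
  cos-1-constant = trans (+-congʳ (*-congˡ 1#-homo)) (solve 0 (:1 :* :1 :- :1 := :0) refl)

  sin-constant : sin 0 ≈ 0#
  sin-constant = solve 1 (λ x → :- :1 :* (:⟦ 1 ⟧ :* (:0 :* x)) := :0) refl (1/ 1 !)

  ε-origin : ε 0 0 0 ≈ 1#
  ε-origin = solve 0 (:⟦ 1 ⟧ :* (:1 :* :1 :+ :0) := :1) refl

  ε-origin-suc : ∀ p m → ε 0 p (suc m) ≈ 0#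
  ε-origin-suc p m = trans (*-congˡ (+-congʳ (*-congˡ (+-congʳ (*-congʳ sin-constant)))))
    (solve 2 (λ x y → :⟦ 1 ⟧ :* (x :* (:0 :* y :+ :0) :+ :0) := :0) refl ((cos-1 ^ₛ p) 0) ((sin ^ₛ m) 0))

  ε-vanishes : ∀ {k p} m → k < p → ε k p m ≈ 0#
  ε-vanishes {zero}  {suc p} m _         = trans (*-congˡ (+-congʳ (*-congʳ (+-congʳ (*-congʳ cos-1-constant)))))
    (solve 2 (λ x y → :⟦ 1 ⟧ :* ((:0 :* y :+ :0) :* x :+ :0) := :0) refl ((sin ^ₛ m) 0) ((cos-1 ^ₛ p) 0))
  ε-vanishes {suc k} {suc p} m (s≤s k<p) = begin
    ε (suc k) (suc p) m
      ≈⟨ ε-step k (suc p) m ⟩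
    - (⟦ suc p ⟧ * ε k p (suc m)) + ⟦ m ⟧ * (ε k (suc p) (pred m) + ε k (suc (suc p)) (pred m))
      ≈⟨ +-cong (-‿cong (*-congˡ (ε-vanishes (suc m) k<p))) (*-congˡ (+-cong
           (ε-vanishes (pred m) (ℕ.m≤n⇒m≤1+n k<p)) (ε-vanishes (pred m) (ℕ.m≤n⇒m≤1+n (ℕ.m≤n⇒m≤1+n k<p))))) ⟩
    - (⟦ suc p ⟧ * 0#) + ⟦ m ⟧ * (0# + 0#)
      ≈⟨ solve 2 (λ p m → :- (p :* :0) :+ m :* (:0 :+ :0) := :0) refl ⟦ suc p ⟧ ⟦ m ⟧ ⟩
    0# ∎

-- The binomial series of secᵗ and the array of derivatives.

module SecantPower {c ℓ : Level} (A : CommutativeℚAlgebra c ℓ) (t : CommutativeℚAlgebra.Carrier A) where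
  open CommutativeℚAlgebra A hiding (zero)
  open Series A
  open Solver A
  open Scalars A
  open RangeSums A
  open PowerSeries A
  open Cosine A
  open Derivatives A t
  open IsRingHomomorphism ι-isRingHomomorphism using (1#-homo)
  open MonoidSum *-commutativeMonoid using () renaming (sum to product; sum-cong-≋ to product-cong)
  open SetoidReasoning setoid

  falling : Carrier → ℕ → Carrier
  falling a p = product {p} (λ i → a - ⟦ toℕ i ⟧)

  falling-cong : ∀ {a b} p → a ≈ b → falling a p ≈ falling b p
  falling-cong p a≈b = product-cong {p} (λ i → +-congʳ a≈b)

  falling-first : ∀ a p → falling a (suc p) ≈ a * falling (a - 1#) p
  falling-first a p = *-cong (solve 1 (λ a → a :- :0 := a) refl a)
    (product-cong {p} (λ i → solve 2 (λ a n → a :- (:1 :+ n) := a :- :1 :- n) refl a ⟦ toℕ i ⟧))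

  falling-last : ∀ a p → falling a (suc p) ≈ falling a p * (a - ⟦ p ⟧)
  falling-last a p = RangeFold.sum-last *-monoid p (λ i → a - ⟦ i ⟧)

  binomial-cong : ∀ {a b} p → a ≈ b → binomial a p ≈ binomial b p
  binomial-cong p a≈b = *-congʳ (falling-cong p a≈b)

  binomial-zero : ∀ a → binomial a 0 ≈ 1#
  binomial-zero a = trans (*-identityˡ _) 1#-homo

  binomial-absorb : ∀ a p → binomial a (suc p) * ⟦ suc p ⟧ ≈ a * binomial (a - 1#) p
  binomial-absorb a p = begin
    falling a (suc p) * 1/ suc p ! * ⟦ suc p ⟧
      ≈⟨ solve 3 (λ f x n → f :* x :* n := f :* (n :* x)) refl _ _ _ ⟩
    falling a (suc p) * (⟦ suc p ⟧ * 1/ suc p !)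
      ≈⟨ *-cong (falling-first a p) (1/!-step p) ⟩
    a * falling (a - 1#) p * 1/ p !
      ≈⟨ *-assoc _ _ _ ⟩
    a * binomial (a - 1#) p ∎

  binomial-pascal : ∀ a p → binomial a (suc p) ≈ binomial (a - 1#) (suc p) + binomial (a - 1#) p
  binomial-pascal a p = begin
    falling a (suc p) * x
      ≈⟨ *-congʳ (falling-first a p) ⟩
    a * F * x
      ≈⟨ solve 4 (λ a f x n → a :* f :* x := f :* (a :- :1 :- n) :* x :+ f :* ((:1 :+ n) :* x)) refl a F x ⟦ p ⟧ ⟩
    F * (a - 1# - ⟦ p ⟧) * x + F * (⟦ suc p ⟧ * x)
      ≈⟨ +-cong (*-congʳ (sym (falling-last (a - 1#) p))) (*-congˡ (1/!-step p)) ⟩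
    binomial (a - 1#) (suc p) + binomial (a - 1#) p ∎
    where
    F = falling (a - 1#) p
    x = 1/ suc p !

  β : ℕ → ℕ → Carrier
  β m = binomial (- t - ⟦ m ⟧)

  private
    minus-suc : ∀ m → - t - ⟦ suc m ⟧ ≈ - t - ⟦ m ⟧ - 1#
    minus-suc m = solve 2 (λ t n → :- t :- (:1 :+ n) := :- t :- n :- :1) refl t ⟦ m ⟧

  -- Coefficient form of the derivative a uᵃ⁻¹ of uᵃ, with a = -t-m.
  β-absorb : ∀ m p → ⟦ suc p ⟧ * β m (suc p) ≈ - (t + ⟦ m ⟧) * β (suc m) p
  β-absorb m p = trans (*-comm _ _) (trans (binomial-absorb (- t - ⟦ m ⟧) p)
    (*-cong (solve 2 (λ t n → :- t :- n := :- (t :+ n)) refl t ⟦ m ⟧) (binomial-cong p (sym (minus-suc m)))))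

  -- Coefficient form of uᵃ = (1 + (u - 1)) uᵃ⁻¹; it absorbs the factor cos produced by
  -- differentiating a power of sin.
  β-pascal : ∀ m p → β m (suc p) ≈ β (suc m) (suc p) + β (suc m) p
  β-pascal m p = trans (binomial-pascal (- t - ⟦ m ⟧) p)
    (sym (+-cong (binomial-cong (suc p) (minus-suc m)) (binomial-cong p (minus-suc m))))

  -- secᵗ tanᵐ = cos⁻ᵗ⁻ᵐ sinᵐ, and the first factor is expanded in powers of cos - 1.
  e-binomial : ∀ k m N → k < N → e k m ≈ Σ< N (λ p → β m p * ε k p m)
  e-binomial zero zero (suc N) _ = sym (trans
    (+-cong (*-cong (binomial-zero (- t - ⟦ 0 ⟧)) ε-origin)
      (Σ<-zero N λ p → trans (*-congˡ (ε-vanishes {p = suc p} 0 (s≤s z≤n))) (zeroʳ (β 0 (suc p)))))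
    (solve 0 (:1 :* :1 :+ :0 := :1) refl))
  e-binomial zero (suc m) N _ =
    sym (Σ<-zero N λ p → trans (*-congˡ (ε-origin-suc p m)) (zeroʳ (β (suc m) p)))
  e-binomial (suc k) m (suc N) (s≤s k<N) = sym (begin
    Σ< (suc N) (λ p → β m p * ε (suc k) p m)
      ≈⟨ Σ<-cong (suc N) (λ p → trans (*-congˡ (ε-step k p m))
           (solve 6 (λ b p x m y z → b :* (:- (p :* x) :+ m :* (y :+ z)) := :- :1 :* (p :* b :* x) :+ m :* (b :* y :+ b :* z)) refl
             (β m p) ⟦ p ⟧ (ε k (pred p) (suc m)) ⟦ m ⟧ (ε k p (pred m)) (ε k (suc p) (pred m)))) ⟩
    Σ< (suc N) (λ p → - 1# * x p + ⟦ m ⟧ * z p)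
      ≈⟨ trans (Σ<-+ (suc N) (λ p → - 1# * x p) (λ p → ⟦ m ⟧ * z p)) (+-cong (Σ<-* (suc N) (- 1#) x) (Σ<-* (suc N) ⟦ m ⟧ z)) ⟩
    - 1# * Σ< (suc N) x + ⟦ m ⟧ * Σ< (suc N) z
      ≈⟨ +-cong (*-congˡ sum-x) (sum-z m) ⟩
    - 1# * (- (t + ⟦ m ⟧) * e k (suc m)) + ⟦ m ⟧ * e k (pred m)
      ≈⟨ +-congʳ (solve 2 (λ a x → :- :1 :* (:- a :* x) := a :* x) refl (t + ⟦ m ⟧) (e k (suc m))) ⟩
    e (suc k) m ∎)
    where
    x z : ℕ → Carrier
    x p = ⟦ p ⟧ * β m p * ε k (pred p) (suc m)
    z p = β m p * ε k p (pred m) + β m p * ε k (suc p) (pred m)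
    sum-x : Σ< (suc N) x ≈ - (t + ⟦ m ⟧) * e k (suc m)
    sum-x = begin
      0# * β m 0 * ε k 0 (suc m) + Σ< N (λ p → ⟦ suc p ⟧ * β m (suc p) * ε k p (suc m))
        ≈⟨ +-cong (solve 2 (λ a b → :0 :* a :* b := :0) refl (β m 0) (ε k 0 (suc m)))
             (Σ<-cong N λ p → trans (*-congʳ {x = ε k p (suc m)} (β-absorb m p)) (*-assoc (- (t + ⟦ m ⟧)) (β (suc m) p) (ε k p (suc m)))) ⟩
      0# + Σ< N (λ p → - (t + ⟦ m ⟧) * (β (suc m) p * ε k p (suc m)))
        ≈⟨ trans (+-identityˡ _) (Σ<-* N (- (t + ⟦ m ⟧)) (λ p → β (suc m) p * ε k p (suc m))) ⟩
      - (t + ⟦ m ⟧) * Σ< N (λ p → β (suc m) p * ε k p (suc m))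
        ≈⟨ *-congˡ (e-binomial k (suc m) N k<N) ⟨
      - (t + ⟦ m ⟧) * e k (suc m) ∎
    sum-z : ∀ m → ⟦ m ⟧ * Σ< (suc N) (λ p → β m p * ε k p (pred m) + β m p * ε k (suc p) (pred m)) ≈ ⟦ m ⟧ * e k (pred m)
    sum-z zero    = trans (zeroˡ _) (sym (zeroˡ _))
    sum-z (suc m) = *-congˡ (begin
      Σ< (suc N) (λ p → u p + w p)
        ≈⟨ Σ<-+ (suc N) u w ⟩
      Σ< (suc N) u + Σ< (suc N) w
        -- The last term of the second sum carries (cos - 1) to the power N+1 > k and vanishes;
        -- without it both sums pair up for Pascal's rule.
        ≈⟨ +-congˡ (trans (Σ<-last N w) (trans (+-congˡ (trans (*-congˡ (ε-vanishes m (ℕ.m≤n⇒m≤1+n k<N))) (zeroʳ _))) (+-identityʳ _))) ⟩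
      β (suc m) 0 * ε k 0 m + Σ< N (u ∘ suc) + Σ< N w
        ≈⟨ +-assoc _ _ _ ⟩
      β (suc m) 0 * ε k 0 m + (Σ< N (u ∘ suc) + Σ< N w)
        ≈⟨ +-cong (*-congʳ (trans (binomial-zero (- t - ⟦ suc m ⟧)) (sym (binomial-zero (- t - ⟦ m ⟧))))) (sym (Σ<-+ N (u ∘ suc) w)) ⟩
      β m 0 * ε k 0 m + Σ< N (λ p → u (suc p) + w p)
        ≈⟨ +-congˡ (Σ<-cong N λ p → trans (sym (distribʳ (ε k (suc p) m) (β (suc m) (suc p)) (β (suc m) p)))
             (*-congʳ {x = ε k (suc p) m} (sym (β-pascal m p)))) ⟩
      Σ< (suc N) (λ p → β m p * ε k p m)
        ≈⟨ e-binomial k m (suc N) (ℕ.m≤n⇒m≤1+n k<N) ⟨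
      e k m ∎)
      where
      u w : ℕ → Carrier
      u p = β (suc m) p * ε k p m
      w p = β (suc m) p * ε k (suc p) m

  egfCoeff-secᵗ : ∀ k → egfCoeff (cos ^^ (- t)) k ≈ e k 0
  egfCoeff-secᵗ k = begin
    ⟦ k ! ⟧ * Σ< (suc k) (λ p → binomial (- t) p * (cos-1 ^ₛ p) k)
      ≈⟨ Σ<-* (suc k) ⟦ k ! ⟧ (λ p → binomial (- t) p * (cos-1 ^ₛ p) k) ⟨
    Σ< (suc k) (λ p → ⟦ k ! ⟧ * (binomial (- t) p * (cos-1 ^ₛ p) k))
      ≈⟨ Σ<-cong (suc k) (λ p → trans
           (solve 3 (λ n b x → n :* (b :* x) := b :* (n :* x)) refl ⟦ k ! ⟧ (binomial (- t) p) ((cos-1 ^ₛ p) k))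
           (*-cong (binomial-cong p (solve 1 (λ t → :- t := :- t :- :0) refl t))
             (*-congˡ {x = ⟦ k ! ⟧} (sym (*ₛ-identityʳ (cos-1 ^ₛ p) k))))) ⟩
    Σ< (suc k) (λ p → β 0 p * ε k p 0)
      ≈⟨ e-binomial k 0 (suc k) (ℕ.n<1+n k) ⟨
    e k 0 ∎

  egfCoeff-[1+X]* : ∀ u k → egfCoeff ((1ₛ +ₛ X) *ₛ u) (suc k) ≈ egfCoeff u (suc k) + ⟦ suc k ⟧ * egfCoeff u k
  egfCoeff-[1+X]* u k = begin
    ⟦ suc k ! ⟧ * ((1# + 0#) * u (suc k) + (shift (1ₛ +ₛ X) *ₛ u) k)
      ≈⟨ *-congˡ (+-congˡ (trans (*ₛ-congʳ u {shift (1ₛ +ₛ X)} {1ₛ} shift-[1+X] k) (*ₛ-identityˡ u k))) ⟩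
    ⟦ suc k ! ⟧ * ((1# + 0#) * u (suc k) + u k)
      ≈⟨ solve 3 (λ n x y → n :* ((:1 :+ :0) :* x :+ y) := n :* x :+ n :* y) refl ⟦ suc k ! ⟧ (u (suc k)) (u k) ⟩
    ⟦ suc k ! ⟧ * u (suc k) + ⟦ suc k ! ⟧ * u k
      ≈⟨ +-congˡ (trans (*-congʳ (⟦⟧-* (suc k) (k !))) (*-assoc _ _ _)) ⟩
    egfCoeff u (suc k) + ⟦ suc k ⟧ * egfCoeff u k ∎
    where
    shift-[1+X] : ∀ i → shift (1ₛ +ₛ X) i ≈ 1ₛ i
    shift-[1+X] zero    = +-identityˡ 1#
    shift-[1+X] (suc i) = +-identityˡ 0#

-- Assembling the closed form and its constant.

module Evaluation {c ℓ : Level} (A : CommutativeℚAlgebra c ℓ) where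
  open CommutativeℚAlgebra A hiding (zero)
  open Series A
  open Solver A
  open Determinant A
  open PochhammerSymbol A
  open Scalars A
  open SetoidReasoning setoid
  open MonoidSum *-commutativeMonoid using ()
    renaming (sum to product; sum-cong-≋ to product-cong; ∑-distrib-+ to ∏-distrib-*)

  product-⟦⟧ : ∀ n (g : ℕ → ℕ) → product {n} (λ i → ⟦ g (toℕ i) ⟧) ≈ ⟦ Πℕ.sum {n} (λ i → g (toℕ i)) ⟧
  product-⟦⟧ zero    g = sym (+-identityʳ 1#)
  product-⟦⟧ (suc n) g = trans (*-congˡ (product-⟦⟧ n (g ∘ suc))) (sym (⟦⟧-* (g 0) (Πℕ.sum {n} (λ i → g (suc (toℕ i))))))

  ∏₁-last : ∀ m g → ∏₁ (suc m) g ≈ ∏₁ m g * g (suc m)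
  ∏₁-last m g = RangeFold.sum-last *-monoid m (λ i → g (suc i))

  ⟦∏pivot⟧≈constant : ∀ m → ⟦ ∏pivot m ⟧ ≈ ι (constant (suc m))
  ⟦∏pivot⟧≈constant m = cancel-⟦⟧ (superfactorial m) {{superfactorial≢0 m}} (begin
    ⟦ superfactorial m ⟧ * ⟦ ∏pivot m ⟧           ≈⟨ *-comm _ _ ⟩
    ⟦ ∏pivot m ⟧ * ⟦ superfactorial m ⟧           ≈⟨ ⟦⟧-* (∏pivot m) (superfactorial m) ⟨
    ⟦ ∏pivot m ℕ.* superfactorial m ⟧             ≡⟨ ≡.cong ⟦_⟧ (∏pivot*superfactorial m) ⟩
    ⟦ numerator m ⟧                               ≈⟨ ι-/-* (numerator m) (superfactorial m) {{superfactorial≢0 m}} ⟨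
    ι (constant (suc m)) * ⟦ superfactorial m ⟧   ≈⟨ *-comm _ _ ⟩
    ⟦ superfactorial m ⟧ * ι (constant (suc m))   ∎)

  module _ (s : Carrier) where
    open Derivatives A (s + 1#)
    open SecantPower A (s + 1#)
    open Reduction A (s + 1#) using (det-M)

    egfCoeff-f : ∀ k → egfCoeff (f s) k ≈ e k 0 + y k 0
    egfCoeff-f zero    = trans (solve 1 (λ x → :⟦ 1 ⟧ :* ((:1 :+ :0) :* x :+ :0) := :⟦ 1 ⟧ :* x :+ :0) refl ((cos ^^ (- (s + 1#))) 0))
      (+-congʳ (egfCoeff-secᵗ 0))
    egfCoeff-f (suc k) = trans (egfCoeff-[1+X]* (cos ^^ (- (s + 1#))) k)
      (+-cong (egfCoeff-secᵗ (suc k)) (*-congˡ (egfCoeff-secᵗ k)))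

    dilatedHankel-f : ∀ N → dilatedHankel N (f s) ≈
      product {N} (λ i → ⟦ pivot (toℕ i) ⟧ * pochhammer (s + 1#) (toℕ i))
    dilatedHankel-f N = trans
      (det-cong N λ i j → trans (reflexive (≡.cong (egfCoeff (f s))
          (≡.trans (ℕ.+-comm (2 ℕ.* toℕ i) (toℕ j)) (≡.cong (toℕ j ℕ.+_) (≡.sym (dbl≡2* (toℕ i)))))))
        (egfCoeff-f (toℕ j ℕ.+ dbl (toℕ i))))
      (det-M N)

    dilatedHankel-closed : ∀ m → dilatedHankel (suc m) (f s) ≈ ι (constant (suc m)) * ∏₁ m (pochhammer (s + 1#))
    dilatedHankel-closed m = begin
      dilatedHankel (suc m) (f s)
        ≈⟨ dilatedHankel-f (suc m) ⟩
      product {suc m} (λ i → ⟦ pivot (toℕ i) ⟧ * pochhammer (s + 1#) (toℕ i))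
        -- The Pochhammer factor at i = 0 is an empty product, which leaves the indices 1 to m.
        ≈⟨ ∏-distrib-* {suc m} (λ i → ⟦ pivot (toℕ i) ⟧) (λ i → pochhammer (s + 1#) (toℕ i)) ⟩
      product {suc m} (λ i → ⟦ pivot (toℕ i) ⟧) * (1# * ∏₁ m (pochhammer (s + 1#)))
        ≈⟨ *-cong (trans (product-⟦⟧ (suc m) pivot) (⟦∏pivot⟧≈constant m)) (*-identityˡ _) ⟩
      ι (constant (suc m)) * ∏₁ m (pochhammer (s + 1#)) ∎

  pochhammer-1 : ∀ m → pochhammer (0# + 1#) m ≈ ⟦ m ! ⟧
  pochhammer-1 zero    = sym (+-identityʳ 1#)
  pochhammer-1 (suc m) = begin
    pochhammer (0# + 1#) (suc m)
      ≈⟨ pochhammer-last (0# + 1#) m ⟩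
    pochhammer (0# + 1#) m * (0# + 1# + ⟦ m ⟧)
      ≈⟨ *-cong (pochhammer-1 m) (+-congʳ (+-identityˡ 1#)) ⟩
    ⟦ m ! ⟧ * ⟦ suc m ⟧
      ≈⟨ *-comm _ _ ⟩
    ⟦ suc m ⟧ * ⟦ m ! ⟧
      ≈⟨ ⟦⟧-* (suc m) (m !) ⟨
    ⟦ suc m ! ⟧ ∎

  constant≈dilatedHankel : ∀ m → ι (constant (suc m)) ≈
    dilatedHankel (suc m) (f 0#) * ι (((+ 1) / superfactorial m) {{superfactorial≢0 m}})
  constant≈dilatedHankel m = sym (begin
    dilatedHankel (suc m) (f 0#) * r
      ≈⟨ *-congʳ (dilatedHankel-closed 0# m) ⟩
    κ * ∏₁ m (pochhammer (0# + 1#)) * r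
      ≈⟨ *-congʳ (*-congˡ (trans (product-cong {m} (λ i → pochhammer-1 (suc (toℕ i)))) (product-⟦⟧ m (_! ∘ suc)))) ⟩
    κ * ⟦ superfactorial m ⟧ * r
      ≈⟨ solve 3 (λ c n r → c :* n :* r := c :* (r :* n)) refl κ ⟦ superfactorial m ⟧ r ⟩
    κ * (r * ⟦ superfactorial m ⟧)
      ≈⟨ *-congˡ (trans (ι-/-* 1 (superfactorial m) {{superfactorial≢0 m}}) (+-identityʳ 1#)) ⟩
    κ * 1#
      ≈⟨ *-identityʳ κ ⟩
    κ ∎)
    where
    κ = ι (constant (suc m))
    r = ι (((+ 1) / superfactorial m) {{superfactorial≢0 m}})

  pochhammer≈∏ : ∀ s m → pochhammer (s + 1#) m ≈ ∏₁ m (λ j → s + ⟦ j ⟧)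
  pochhammer≈∏ s m = product-cong {m} (λ i → +-assoc s 1# ⟦ toℕ i ⟧)

  -- The factor s+j occurs in (s+1)ᵢ exactly when i ≥ j, hence m+1-j times for i from 1 to m;
  -- appending (s+1)ₘ₊₁ raises every exponent by one.
  ∏pochhammer : ∀ s m → ∏₁ m (pochhammer (s + 1#)) ≈ ∏₁ m (λ j → (s + ⟦ j ⟧) ^ (suc m ∸ j))
  ∏pochhammer s zero    = refl
  ∏pochhammer s (suc m) = begin
    ∏₁ (suc m) (pochhammer (s + 1#))
      ≈⟨ ∏₁-last m (pochhammer (s + 1#)) ⟩
    ∏₁ m (pochhammer (s + 1#)) * pochhammer (s + 1#) (suc m)
      ≈⟨ *-cong (∏pochhammer s m) (trans (pochhammer≈∏ s (suc m)) (∏₁-last m (λ j → s + ⟦ j ⟧))) ⟩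
    ∏₁ m (λ j → (s + ⟦ j ⟧) ^ (suc m ∸ j)) * (∏₁ m (λ j → s + ⟦ j ⟧) * (s + ⟦ suc m ⟧))
      ≈⟨ solve 3 (λ a b x → a :* (b :* x) := b :* a :* x) refl _ _ _ ⟩
    ∏₁ m (λ j → s + ⟦ j ⟧) * ∏₁ m (λ j → (s + ⟦ j ⟧) ^ (suc m ∸ j)) * (s + ⟦ suc m ⟧)
      ≈⟨ *-cong (∏-distrib-* {m} (λ i → s + ⟦ suc (toℕ i) ⟧) (λ i → (s + ⟦ suc (toℕ i) ⟧) ^ (m ∸ toℕ i))) (power-1 (s + ⟦ suc m ⟧) m) ⟨
    ∏₁ m (λ j → (s + ⟦ j ⟧) * (s + ⟦ j ⟧) ^ (suc m ∸ j)) * (s + ⟦ suc m ⟧) ^ (suc m ∸ m)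
      ≈⟨ *-congʳ (product-cong {m} λ i → reflexive (≡.cong ((s + ⟦ suc (toℕ i) ⟧) ^_) (≡.sym (ℕ.+-∸-assoc 1 (ℕ.<⇒≤ (Fin.toℕ<n i)))))) ⟩
    ∏₁ m (λ j → (s + ⟦ j ⟧) ^ (suc (suc m) ∸ j)) * (s + ⟦ suc m ⟧) ^ (suc m ∸ m)
      ≈⟨ ∏₁-last m (λ j → (s + ⟦ j ⟧) ^ (suc (suc m) ∸ j)) ⟨
    ∏₁ (suc m) (λ j → (s + ⟦ j ⟧) ^ (suc (suc m) ∸ j)) ∎
    where
    power-1 : ∀ x m → x ^ (suc m ∸ m) ≈ x
    power-1 x m = trans (reflexive (≡.cong (x ^_) (≡.trans (ℕ.+-∸-assoc 1 (ℕ.≤-refl {m})) (≡.cong suc (ℕ.n∸n≡0 m))))) (*-identityʳ x)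

theorem12p1 :
  ∀ {c ℓ : Level} (A : CommutativeℚAlgebra c ℓ) →
  let open CommutativeℚAlgebra A
      open Series A
  in
  (n : ℕ) → 1 ≤ n → (s : Carrier) →
    (dilatedHankel n (f s)
      ≈ ι (constant n) * ∏₁ (n ∸ 1) (λ i → pochhammer (s + 1#) i))
    × (ι (constant n) * ∏₁ (n ∸ 1) (λ i → pochhammer (s + 1#) i)
      ≈ ι (constant n) * ∏₁ (n ∸ 1) (λ j → (s + ⟦ j ⟧) ^ (n ∸ j)))
    × (ι (constant n)
      ≈ dilatedHankel n (f 0#)
        * ι (((+ 1) / superfactorial (n ∸ 1)) {{superfactorial≢0 (n ∸ 1)}}))
theorem12p1 A (suc m) _ s =
  dilatedHankel-closed s m , *-congˡ (∏pochhammer s m) , constant≈dilatedHankel m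
  where
  open CommutativeℚAlgebra A using (*-congˡ)
  open Evaluation A
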